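{- Let $G$ be a Laman graph. If $G$ is not $\triangle$-connected, then either $G$ has a NAC-coloring, or there exists a problematic graph $\widetilde G$ which has no NAC-coloring such that $G$ can be constructed from $\widetilde G$ by a (possibly empty) sequence of Henneberg moves (possibly $G=\widetilde G$).
   Context: Graphs are finite, simple, undirected. A graph $G$ is a Laman graph if $|E_G|=2|V_G|-3$ and every subgraph $H$ with at least two vertices satisfies $|E_H|\le 2|V_H|-3$. For a graph $G$, let $\sim'$ be the relation on $E_G$ with $e_1\sim' e_2$ iff some triangle subgraph contains both, and $\sim$ its reflexive-transitive closure; $G$ is $\triangle$-connected if $e_1\sim e_2$ for all $e_1,e_2\in E_G$. A coloring $\delta\colon E_G\to\{\text{blue},\text{red}\}$ is a NAC-coloring if it is surjective and $G$ has no cycle with exactly one blue edge and no cycle with exactly one red edge. Henneberg moves: from a graph $G'=(V',E')$ and a new vertex $v\notin V'$, a move of type I from distinct $u,u'\in V'$ gives $V_G=V'\cup\{v\}$, $E_G=E'\cup\{uv,u'v\}$; a move of type II from distinct $u,u_1,u_2\in V'$ with $u_1u_2\in E'$ gives $V_G=V'\cup\{v\}$, $E_G=(E'\setminus\{u_1u_2\})\cup\{uv,u_1v,u_2v\}$. "$G$ can be constructed from $\widetilde G$ by Henneberg moves" means there is a sequence of Laman graphs $\widetilde G=G_k,G_{k+1},\dots,G_n=G$ with each $G_{i}$ obtained from $G_{i-1}$ by a Henneberg move of type I or II. A Laman graph $\widetilde G$ is problematic if: (1) every vertex has degree at least $3$; (2) for every vertex $v$ of degree $3$, exactly two of the neighbors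 of $v$ are joined by an edge and both of these have degree at least $4$; (3) every vertex lies in some triangle (subgraph isomorphic to $C_3$). -}

module Defs where

open import Data.Nat using (ℕ; zero; suc; _+_; _*_; _≤_; _<_)
open import Data.Bool using (Bool; true; false; T; not; _∧_; if_then_else_)
open import Data.Fin using (Fin; toℕ; punchIn)
open import Data.List using (List; []; _∷_; length; filter; map; allFin)
open import Data.Nat.ListAction using (sum)
open import Data.List.Relation.Unary.All using (All)
open import Data.List.Relation.Unary.Unique.Propositional using (Unique)
open import Data.Product using (Σ; ∃; ∃-syntax; _×_; _,_; proj₁; proj₂)
open import Data.Sum using (_⊎_)
open import Relation.Nullary using (¬_)
open import Relation.Binary.PropositionalEquality using (_≡_; _≢_)
open import Relation.Binary.Construct.Closure.ReflexiveTransitive using (Star)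
open import Function.Bundles using (_⇔_)

record Graph : Set where
  field
    n     : ℕ
    adj   : Fin n → Fin n → Bool
    sym   : ∀ x y → adj x y ≡ adj y x
    irrefl : ∀ x → adj x x ≡ false
open Graph public

Adj : (G : Graph) → Fin (n G) → Fin (n G) → Set
Adj G x y = T (adj G x y)

count : {m : ℕ} → (Fin m → Bool) → ℕ
count {m} p = length (filter (λ x → Data.Bool._≟_ (p x) true) (allFin m))
  where import Data.Bool

countPairs : {m : ℕ} → (Fin m → Fin m → Bool) → ℕ
countPairs {m} P = sum (map (λ x → count (λ y → lt x y ∧ P x y)) (allFin m))
  where
  open import Data.Nat using (_<ᵇ_)
  lt : Fin m → Fin m → Bool
  lt x y = toℕ x <ᵇ toℕ y

numEdges : Graph → ℕ
numEdges G = countPairs (adj G)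

degree : (G : Graph) → Fin (n G) → ℕ
degree G v = count (adj G v)

record Subgraph (G : Graph) : Set where
  field
    S : Fin (n G) → Bool
    F : Fin (n G) → Fin (n G) → Bool
    F-sym : ∀ x y → F x y ≡ F y x
    F-sub : ∀ x y → T (F x y) → Adj G x y × T (S x) × T (S y)
open Subgraph public

-- Laman: |E| = 2|V| - 3 (integer arithmetic, written as |E| + 3 = 2|V|)
-- and every subgraph H with ≥ 2 vertices has |E_H| ≤ 2|V_H| - 3.
IsLaman : Graph → Set
IsLaman G =
  (numEdges G + 3 ≡ 2 * n G) ×
  ((H : Subgraph G) → 2 ≤ count (S H) → countPairs (F H) + 3 ≤ 2 * count (S H))

IsTriangle : (G : Graph) → Fin (n G) → Fin (n G) → Fin (n G) → Set
IsTriangle G a b c = Adj G a b × Adj G b c × Adj G a c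

Edge : Graph → Set
Edge G = Σ (Fin (n G) × Fin (n G)) λ p → (toℕ (proj₁ p) < toℕ (proj₂ p)) × Adj G (proj₁ p) (proj₂ p)

_∈₃_ : {m : ℕ} → Fin m → Fin m × Fin m × Fin m → Set
x ∈₃ (a , b , c) = x ≡ a ⊎ x ≡ b ⊎ x ≡ c

EdgeIn : (G : Graph) → Edge G → Fin (n G) × Fin (n G) × Fin (n G) → Set
EdgeIn G ((x , y) , _) t = x ∈₃ t × y ∈₃ t

TriRel : (G : Graph) → Edge G → Edge G → Set
TriRel G e₁ e₂ = ∃[ a ] ∃[ b ] ∃[ c ]
  (IsTriangle G a b c × EdgeIn G e₁ (a , b , c) × EdgeIn G e₂ (a , b , c))

TriConnected : Graph → Set
TriConnected G = (e₁ e₂ : Edge G) → Star (TriRel G) e₁ e₂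

data Color : Set where
  blue red : Color

isBlue : Color → Bool
isBlue blue = true
isBlue red  = false

isRed : Color → Bool
isRed c = not (isBlue c)

cycleEdges : {A : Set} → List A → List (A × A)
cycleEdges [] = []
cycleEdges {A} (v₀ ∷ vs) = go v₀ vs
  where
  go : A → List A → List (A × A)
  go x [] = (x , v₀) ∷ []
  go x (y ∷ ys) = (x , y) ∷ go y ys

IsCycle : (G : Graph) → List (Fin (n G)) → Set
IsCycle G vs = 3 ≤ length vs × Unique vs ×
  All (λ p → Adj G (proj₁ p) (proj₂ p)) (cycleEdges vs)

record EdgeColoring (G : Graph) : Set where
  field
    col : Fin (n G) → Fin (n G) → Color
    col-sym : ∀ x y → Adj G x y → col x y ≡ col y x
open EdgeColoring public

numColored : (G : Graph) → EdgeColoring G → (Color → Bool) → List (Fin (n G)) → ℕ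
numColored G δ p vs =
  length (filter (λ e → Data.Bool._≟_ (p (col δ (proj₁ e) (proj₂ e))) true) (cycleEdges vs))
  where import Data.Bool

IsNAC : (G : Graph) → EdgeColoring G → Set
IsNAC G δ =
  (∃[ x ] ∃[ y ] (Adj G x y × col δ x y ≡ blue)) ×
  (∃[ x ] ∃[ y ] (Adj G x y × col δ x y ≡ red)) ×
  ((vs : List (Fin (n G))) → IsCycle G vs → numColored G δ isBlue vs ≢ 1) ×
  ((vs : List (Fin (n G))) → IsCycle G vs → numColored G δ isRed vs ≢ 1)

HasNAC : Graph → Set
HasNAC G = ∃[ δ ] IsNAC G δ

-- Henneberg moves.  G' has vertices Fin m, G has vertices Fin (suc m);
-- the new vertex is v, and the old vertices are embedded via punchIn v
-- (a bijection from Fin m onto the vertices ≠ v).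

HennebergI : (G' G : Graph) → Set
HennebergI G' G = Σ (n G ≡ suc (n G')) λ { _≡_.refl →
  ∃[ v ] ∃[ u ] ∃[ u' ] (u ≢ u' ×
    (∀ x y → Adj G (punchIn v x) (punchIn v y) ⇔ Adj G' x y) ×
    (∀ x → Adj G v (punchIn v x) ⇔ (x ≡ u ⊎ x ≡ u'))) }

HennebergII : (G' G : Graph) → Set
HennebergII G' G = Σ (n G ≡ suc (n G')) λ { _≡_.refl →
  ∃[ v ] ∃[ u ] ∃[ u₁ ] ∃[ u₂ ] (u ≢ u₁ × u ≢ u₂ × u₁ ≢ u₂ × Adj G' u₁ u₂ ×
    (∀ x y → Adj G (punchIn v x) (punchIn v y) ⇔
       (Adj G' x y × ¬ ((x ≡ u₁ × y ≡ u₂) ⊎ (x ≡ u₂ × y ≡ u₁)))) ×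
    (∀ x → Adj G v (punchIn v x) ⇔ (x ≡ u ⊎ x ≡ u₁ ⊎ x ≡ u₂))) }

HennebergMove : (G' G : Graph) → Set
HennebergMove G' G = HennebergI G' G ⊎ HennebergII G' G

data ConstructibleFrom (G̃ : Graph) : Graph → Set where
  done : IsLaman G̃ → ConstructibleFrom G̃ G̃
  step : ∀ {G' G} → ConstructibleFrom G̃ G' → IsLaman G → HennebergMove G' G →
         ConstructibleFrom G̃ G

IsProblematic : Graph → Set
IsProblematic G =
  IsLaman G ×
  (∀ v → 3 ≤ degree G v) ×
  (∀ v → degree G v ≡ 3 →
     ∃[ a ] ∃[ b ] ∃[ c ]
       (Adj G v a × Adj G v b × Adj G v c ×
        a ≢ b × a ≢ c × b ≢ c ×
        Adj G a b × ¬ Adj G a c × ¬ Adj G b c ×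
        4 ≤ degree G a × 4 ≤ degree G b)) ×
  (∀ v → ∃[ b ] ∃[ c ] IsTriangle G v b c)

{-# OPTIONS --safe #-}
module Submission where

-- Induction on the number of vertices. A vertex lying in no triangle gives a NAC-coloring (its star
-- against the rest), and a vertex of degree 2 with adjacent neighbours can be deleted. If all degrees
-- are at least 3 and G is not problematic, some vertex v of degree 3 violates condition (2). If two
-- pairs ab, bc of its neighbours are adjacent, then G - v + ac is again Laman, and each of its
-- NAC-colorings is constant on the triangle abc and so extends to v. If only ab is an edge and a has
-- degree 3 too, with third neighbour x, then either G has an explicit NAC-coloring, or cx is an edge and,
-- up to exchanging v and a, G - v - a + bc is Laman and its NAC-colorings extend to a and v.
-- The graphs G - v + ac and G - v - a + bc are never triangle-connected: a triangle-connected Laman graph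
-- is a 2-tree, so it has two vertices of degree 2, while here at most one vertex has degree below 3.

open import Defs
open import Data.Bool using (Bool; true; false; T; not; _∧_; _∨_; if_then_else_)
import Data.Bool as Bool
open import Data.Bool.Properties using (∧-comm; ∨-comm; ∨-identityʳ; T-≡; T-∧; T-∨; T-irrelevant)
open import Data.Empty using (⊥; ⊥-elim)
open import Data.Fin using (Fin; zero; suc; toℕ; punchIn; punchOut)
open import Data.Fin.Properties
  using (_≟_; <-cmp; all?; any?; ¬∀⟶∃¬; toℕ-injective; punchInᵢ≢i; punchIn-punchOut; punchIn-injective; punchIn-mono-≤; punchIn-cancel-≤)
open import Data.List using (List; []; _∷_; length; filter; map; tabulate; allFin; drop; cartesianProduct)
open import Data.List.Membership.DecPropositional using () renaming (_∈?_ to mem?)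
open import Data.List.Membership.Propositional using (_∈_; _∉_)
open import Data.List.Membership.Propositional.Properties using (∈-filter⁺; ∈-cartesianProduct⁺; ∈-allFin)
open import Data.List.Relation.Unary.All using (All; []; _∷_)
import Data.List.Relation.Unary.All as All
open import Data.List.Relation.Unary.All.Properties using (all-filter; ¬Any⇒All¬)
open import Data.List.Relation.Unary.AllPairs using ([]; _∷_)
open import Data.List.Relation.Unary.Any using (here; there)
open import Data.List.Relation.Unary.Unique.Propositional using (Unique)
open import Data.Maybe using (just; nothing)
open import Data.Maybe.Properties using (just-injective)
open import Data.Nat as ℕ using (ℕ; zero; suc; _+_; _*_; _≤_; _<_; _<ᵇ_; z≤n; s≤s)
open import Data.Nat.Induction using (<-wellFounded; Acc; acc)
import Data.Nat.ListAction as List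
open import Data.Nat.Properties hiding (_≟_; <-cmp)
open import Data.Nat.Tactic.RingSolver using (solve-∀)
open import Data.Product using (Σ; ∃; ∃-syntax; _×_; _,_; proj₁; proj₂)
open import Data.Sum using (_⊎_; inj₁; inj₂; [_,_]′)
open import Data.Unit using (tt)
open import Data.Vec.Functional using (insertAt)
import Data.Vec.Functional as V
open import Data.Vec.Functional.Properties using (insertAt-lookup; insertAt-punchIn)
open import Function using (_∘_; id; mk⇔; Equivalence)
open import Relation.Binary.Construct.Closure.ReflexiveTransitive using (Star; ε; _◅_; _◅◅_; gmap; reverse)
open import Relation.Binary.Definitions using (tri<; tri≈; tri>; DecidableEquality)
open import Relation.Binary.PropositionalEquality as ≡
  using (_≡_; _≢_; _≗_; refl; trans; cong; cong₂; subst; subst₂; module ≡-Reasoning)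
open import Relation.Nullary using (¬_; Dec; yes; no; does; contradiction)
open import Relation.Nullary.Decidable using (dec-true; dec-false; T?; _×-dec_; _⊎-dec_; _→-dec_; ¬?; map′)
open import Algebra.Properties.Semiring.Sum +-*-semiring
  using (sum; sum-cong-≗; ∑-distrib-+; ∑-comm; sum-remove; *-distribˡ-sum)

-- Write `G - v + ac` for the reduced graph. It fails to be Laman exactly when some tight vertex set
-- (one spanning 2|S| - 3 edges) contains a and c but not v. If b is joined to both a and c, such a
-- set can absorb b and then holds three neighbours of v, which sparsity forbids. If only ab is an
-- edge, a tight set may really block bc. The way out is that it cannot be matched by one blocking
-- bx, the edge available after exchanging v and a: either one of the two sets contains b, c and x,
-- or the edge cx makes their union tight; a tight set with b, c, x absorbs a and again holds three
-- neighbours of v. The case where a and b both have degree 3 needs its own coloring: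
-- `G - v - a + bc` costs b one neighbour, so b must start with at least 4 for x to be the only
-- vertex that may drop below 3. Two choices of the argument must be decided: whether a problematic
-- graph has a NAC-coloring, and whether bc is blocked. Both are settled by finite search. For the
-- first, the condition on all cycles is replaced by a condition on single edges, which also makes
-- extending a coloring to a new vertex a local matter.

private variable
  m k : ℕ
  R B X : Set

-- Sums and counting

𝟙 : Bool → ℕ
𝟙 b = if b then 1 else 0

𝟙-T : ∀ {b} → T b → 𝟙 b ≡ 1
𝟙-T {true} _ = refl

𝟙-F : ∀ {b} → ¬ T b → 𝟙 b ≡ 0
𝟙-F {true}  ¬t = ⊥-elim (¬t tt)
𝟙-F {false} _  = refl

T⇔⇒≡ : ∀ {b c} → (T b → T c) → (T c → T b) → b ≡ c
T⇔⇒≡ {true}  {true}  _ _ = refl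
T⇔⇒≡ {false} {false} _ _ = refl
T⇔⇒≡ {true}  {false} f _ = ⊥-elim (f tt)
T⇔⇒≡ {false} {true}  _ g = ⊥-elim (g tt)

eq : Fin m → Fin m → Bool
eq x y = does (x ≟ y)

δ : Fin m → Fin m → ℕ
δ x y = 𝟙 (eq x y)

eq-refl : (x : Fin m) → eq x x ≡ true
eq-refl x = dec-true (x ≟ x) refl

T-eq⇒≡ : {x y : Fin m} → T (eq x y) → x ≡ y
T-eq⇒≡ {x = x} {y} t with x ≟ y
... | yes e = e

≡⇒T-eq : {x y : Fin m} → x ≡ y → T (eq x y)
≡⇒T-eq {x = x} refl rewrite eq-refl x = tt

δ-refl : (x : Fin m) → δ x x ≡ 1
δ-refl x = cong 𝟙 (eq-refl x)

δ-≢ : {x y : Fin m} → x ≢ y → δ x y ≡ 0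
δ-≢ {x = x} {y} x≢y = cong 𝟙 (dec-false (x ≟ y) x≢y)

sum-mono : {f g : Fin m → ℕ} → (∀ x → f x ≤ g x) → sum f ≤ sum g
sum-mono {zero}  f≤g = z≤n
sum-mono {suc m} f≤g = +-mono-≤ (f≤g zero) (sum-mono (f≤g ∘ suc))

sum-0 : sum {m} (λ _ → 0) ≡ 0
sum-0 {zero}  = refl
sum-0 {suc m} = sum-0 {m}

sum-1 : sum {m} (λ _ → 1) ≡ m
sum-1 {zero}  = refl
sum-1 {suc m} = cong suc sum-1

≤-sum : (f : Fin m → ℕ) (x : Fin m) → f x ≤ sum f
≤-sum f zero    = m≤m+n _ _
≤-sum f (suc x) = ≤-trans (≤-sum (f ∘ suc) x) (m≤n+m _ _)

sum-δ* : (z : Fin m) (f : Fin m → ℕ) → sum (λ x → δ z x * f x) ≡ f z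
sum-δ* {suc m} zero    f = trans (cong₂ _+_ (*-identityˡ (f zero)) (sum-0 {m})) (+-identityʳ _)
sum-δ* {suc m} (suc z) f = sum-δ* z (f ∘ suc)

sum-δ : (z : Fin m) → sum (δ z) ≡ 1
sum-δ z = trans (sum-cong-≗ (λ x → ≡.sym (*-identityʳ (δ z x)))) (sum-δ* z (λ _ → 1))

∑∑ : (Fin m → Fin m → ℕ) → ℕ
∑∑ f = sum λ x → sum (f x)

∑∑-cong : {f g : Fin m → Fin m → ℕ} → (∀ x y → f x y ≡ g x y) → ∑∑ f ≡ ∑∑ g
∑∑-cong f≡g = sum-cong-≗ λ x → sum-cong-≗ (f≡g x)

∑∑-mono : {f g : Fin m → Fin m → ℕ} → (∀ x y → f x y ≤ g x y) → ∑∑ f ≤ ∑∑ g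
∑∑-mono f≤g = sum-mono λ x → sum-mono (f≤g x)

∑∑-+ : (f g : Fin m → Fin m → ℕ) → ∑∑ (λ x y → f x y + g x y) ≡ ∑∑ f + ∑∑ g
∑∑-+ f g = trans (sum-cong-≗ λ x → ∑-distrib-+ (f x) (g x)) (∑-distrib-+ (sum ∘ f) (sum ∘ g))

∑∑-δ : (z : Fin m) (f : Fin m → Fin m → ℕ) → ∑∑ (λ x y → δ z x * f x y) ≡ sum (f z)
∑∑-δ z f = trans (sum-cong-≗ λ x → ≡.sym (*-distribˡ-sum (δ z x) (f x))) (sum-δ* z (sum ∘ f))

∑∑-δδ : (a c : Fin m) (f : Fin m → Fin m → ℕ) → ∑∑ (λ x y → δ a x * (δ c y * f x y)) ≡ f a c
∑∑-δδ a c f = trans (∑∑-δ a _) (sum-δ* c (f a))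

double-cancel-≤ : ∀ {a b} → a + a ≤ b + b → a ≤ b
double-cancel-≤ {a} {b} p = *-cancelˡ-≤ 2 (subst₂ _≤_ (e a) (e b) p)
  where
  e : ∀ x → x + x ≡ 2 * x
  e = solve-∀

double-cancel-≡ : ∀ {a b} → a + a ≡ b + b → a ≡ b
double-cancel-≡ p = ≤-antisym (double-cancel-≤ (≤-reflexive p)) (double-cancel-≤ (≤-reflexive (≡.sym p)))

length-filter-∷ : {A : Set} (p : A → Bool) (x : A) (xs : List A) →
  length (filter (λ z → p z Bool.≟ true) (x ∷ xs)) ≡ 𝟙 (p x) + length (filter (λ z → p z Bool.≟ true) xs)
length-filter-∷ p x xs with p x
... | true  = refl
... | false = refl

length-filter-tabulate : {A : Set} (p : A → Bool) (f : Fin m → A) →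
  length (filter (λ z → p z Bool.≟ true) (tabulate f)) ≡ sum (𝟙 ∘ p ∘ f)
length-filter-tabulate {zero}  p f = refl
length-filter-tabulate {suc m} p f =
  trans (length-filter-∷ p (f zero) _) (cong (𝟙 (p (f zero)) +_) (length-filter-tabulate p (f ∘ suc)))

count≡sum : (p : Fin m → Bool) → count p ≡ sum (𝟙 ∘ p)
count≡sum p = length-filter-tabulate p id

sum-map-tabulate : {A : Set} (g : A → ℕ) (f : Fin m → A) → List.sum (map g (tabulate f)) ≡ sum (g ∘ f)
sum-map-tabulate {zero}  g f = refl
sum-map-tabulate {suc m} g f = cong (g (f zero) +_) (sum-map-tabulate g (f ∘ suc))

lt : Fin m → Fin m → Bool
lt x y = toℕ x <ᵇ toℕ y

countPairs≡∑∑ : (P : Fin m → Fin m → Bool) → countPairs P ≡ ∑∑ (λ x y → 𝟙 (lt x y ∧ P x y))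
countPairs≡∑∑ {m} P = trans (sum-map-tabulate {m} (λ x → count (λ y → lt x y ∧ P x y)) id)
  (sum-cong-≗ {m} λ x → count≡sum (λ y → lt x y ∧ P x y))

𝟙lt-tri : (x y : Fin m) → x ≢ y → 𝟙 (lt x y) + 𝟙 (lt y x) ≡ 1
𝟙lt-tri x y x≢y with <-cmp x y
... | tri< p _ ¬q = cong₂ _+_ (𝟙-T (<⇒<ᵇ p)) (𝟙-F {lt y x} (¬q ∘ <ᵇ⇒< _ _))
... | tri≈ _ p _  = contradiction p x≢y
... | tri> ¬p _ q = cong₂ _+_ (𝟙-F {lt x y} (¬p ∘ <ᵇ⇒< _ _)) (𝟙-T (<⇒<ᵇ q))

𝟙-∧ : ∀ a b → 𝟙 (a ∧ b) ≡ 𝟙 a * 𝟙 b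
𝟙-∧ false b = refl
𝟙-∧ true  b = ≡.sym (+-identityʳ _)

∑∑lt-double : (f : Fin m → Fin m → ℕ) → (∀ x y → f x y ≡ f y x) → (∀ x → f x x ≡ 0) →
  let h = ∑∑ (λ x y → 𝟙 (lt x y) * f x y) in h + h ≡ ∑∑ f
∑∑lt-double f f-sym f-irr = begin
  h + h                                                            ≡⟨ cong (h +_) (∑-comm (λ x y → 𝟙 (lt x y) * f x y)) ⟩
  h + ∑∑ (λ x y → 𝟙 (lt y x) * f y x)                              ≡⟨ ∑∑-+ (λ x y → 𝟙 (lt x y) * f x y) (λ x y → 𝟙 (lt y x) * f y x) ⟨
  ∑∑ (λ x y → 𝟙 (lt x y) * f x y + 𝟙 (lt y x) * f y x)             ≡⟨ ∑∑-cong pointwise ⟩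
  ∑∑ f                                                             ∎
  where
  open ≡-Reasoning
  h = ∑∑ (λ x y → 𝟙 (lt x y) * f x y)
  pointwise : ∀ x y → 𝟙 (lt x y) * f x y + 𝟙 (lt y x) * f y x ≡ f x y
  pointwise x y with x ≟ y
  ... | yes refl rewrite f-irr x | *-zeroʳ (𝟙 (lt x x)) = refl
  ... | no x≢y = begin
    𝟙 (lt x y) * f x y + 𝟙 (lt y x) * f y x ≡⟨ cong (λ z → 𝟙 (lt x y) * f x y + 𝟙 (lt y x) * z) (f-sym y x) ⟩
    𝟙 (lt x y) * f x y + 𝟙 (lt y x) * f x y ≡⟨ *-distribʳ-+ (f x y) (𝟙 (lt x y)) (𝟙 (lt y x)) ⟨
    (𝟙 (lt x y) + 𝟙 (lt y x)) * f x y       ≡⟨ cong (_* f x y) (𝟙lt-tri x y x≢y) ⟩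
    1 * f x y                               ≡⟨ *-identityˡ _ ⟩
    f x y                                   ∎

countPairs-double : (P : Fin m → Fin m → Bool) → (∀ x y → P x y ≡ P y x) → (∀ x → P x x ≡ false) →
  countPairs P + countPairs P ≡ ∑∑ (λ x y → 𝟙 (P x y))
countPairs-double P P-sym P-irr
  rewrite trans (countPairs≡∑∑ P) (∑∑-cong λ x y → 𝟙-∧ (lt x y) (P x y)) =
  ∑∑lt-double (λ x y → 𝟙 (P x y)) (λ x y → cong 𝟙 (P-sym x y)) (λ x → cong 𝟙 (P-irr x))

-- Graphs, edge counts and the Laman condition

-- Graphs with a prescribed number of vertices, so that vertices can be deleted by `punchIn`.
record GraphOn (m : ℕ) : Set where
  field
    edge        : Fin m → Fin m → Bool
    edge-sym    : ∀ x y → edge x y ≡ edge y x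
    edge-irrefl : ∀ x → edge x x ≡ false
open GraphOn

graph : GraphOn m → Graph
graph {m} g = record { n = m ; adj = edge g ; sym = edge-sym g ; irrefl = edge-irrefl g }

_⊢_~_ : GraphOn m → Fin m → Fin m → Set
g ⊢ x ~ y = T (edge g x y)

~-sym : (g : GraphOn m) → ∀ {x y} → g ⊢ x ~ y → g ⊢ y ~ x
~-sym g {x} {y} = subst T (edge-sym g x y)

~⇒≢ : (g : GraphOn m) → ∀ {x y} → g ⊢ x ~ y → x ≢ y
~⇒≢ g {x} t refl rewrite edge-irrefl g x = t

A : GraphOn m → Fin m → Fin m → ℕ
A g x y = 𝟙 (edge g x y)

A-sym : (g : GraphOn m) → ∀ x y → A g x y ≡ A g y x
A-sym g x y = cong 𝟙 (edge-sym g x y)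

A-irrefl : (g : GraphOn m) → ∀ x → A g x x ≡ 0
A-irrefl g x = cong 𝟙 (edge-irrefl g x)

-- Vertex sets are represented by their indicator functions, so that inserting a vertex z
-- is adding δ z and all edge counts become (bi)linear.
E : GraphOn m → (Fin m → ℕ) → ℕ
E g s = ∑∑ λ x y → 𝟙 (lt x y) * (s x * (A g x y * s y))

deg : GraphOn m → (Fin m → ℕ) → Fin m → ℕ
deg g s x = sum λ y → A g x y * s y

1s : Fin m → ℕ
1s _ = 1

Q : GraphOn m → (Fin m → ℕ) → ℕ
Q g s = ∑∑ λ x y → s x * (A g x y * s y)

-- The order on vertices, which `E` uses to count each edge once, is awkward under relabelling.
-- Identities for `E` are therefore proved for the symmetric form `Q` and halved with
-- `double-cancel-≡`.
E-double : (g : GraphOn m) (s : Fin m → ℕ) → E g s + E g s ≡ Q g s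
E-double g s = ∑∑lt-double (λ x y → s x * (A g x y * s y)) symm irr
  where
  comm : ∀ a b c → a * (b * c) ≡ c * (b * a)
  comm = solve-∀
  symm : ∀ x y → s x * (A g x y * s y) ≡ s y * (A g y x * s x)
  symm x y rewrite A-sym g x y = comm (s x) (A g y x) (s y)
  irr : ∀ x → s x * (A g x x * s x) ≡ 0
  irr x rewrite A-irrefl g x = *-zeroʳ (s x)

E-cong : (g : GraphOn m) {s t : Fin m → ℕ} → s ≗ t → E g s ≡ E g t
E-cong g s≗t = ∑∑-cong λ x y →
  cong₂ (λ a b → 𝟙 (lt x y) * (a * (A g x y * b))) (s≗t x) (s≗t y)

E-insert : (g : GraphOn m) (s : Fin m → ℕ) (z : Fin m) →
  E g (λ x → s x + δ z x) ≡ E g s + deg g s z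
E-insert g s z = double-cancel-≡ (begin
  E g t + E g t                                         ≡⟨ E-double g t ⟩
  Q g t                                                 ≡⟨ ∑∑-cong expand ⟩
  ∑∑ (λ x y → (q x y + l x y) + (r x y + c x y))        ≡⟨ ∑∑-+ (λ x y → q x y + l x y) (λ x y → r x y + c x y) ⟩
  ∑∑ (λ x y → q x y + l x y) + ∑∑ (λ x y → r x y + c x y) ≡⟨ cong₂ _+_ (∑∑-+ q l) (∑∑-+ r c) ⟩
  (∑∑ q + ∑∑ l) + (∑∑ r + ∑∑ c)                         ≡⟨ cong₂ (λ a b → (Q g s + a) + b) l≡ (cong₂ _+_ r≡ c≡) ⟩
  (Q g s + deg g s z) + (deg g s z + 0)                 ≡⟨ cong (λ a → (a + deg g s z) + (deg g s z + 0)) (≡.sym (E-double g s)) ⟩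
  (E g s + E g s + deg g s z) + (deg g s z + 0)         ≡⟨ rearr (E g s) (deg g s z) ⟩
  (E g s + deg g s z) + (E g s + deg g s z)             ∎)
  where
  open ≡-Reasoning
  t = λ x → s x + δ z x
  q l r c : Fin _ → Fin _ → ℕ
  q x y = s x * (A g x y * s y)
  l x y = δ z x * (A g x y * s y)
  r x y = δ z y * (A g y x * s x)
  c x y = δ z x * (δ z y * A g x y)
  algebra : ∀ a d b e f → (a + d) * (b * (e + f)) ≡ (a * (b * e) + d * (b * e)) + (f * (b * a) + d * (f * b))
  algebra = solve-∀
  expand : ∀ x y → t x * (A g x y * t y) ≡ (q x y + l x y) + (r x y + c x y)
  expand x y rewrite A-sym g y x = algebra (s x) (δ z x) (A g x y) (s y) (δ z y)
  l≡ : ∑∑ l ≡ deg g s z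
  l≡ = ∑∑-δ z (λ x y → A g x y * s y)
  r≡ : ∑∑ r ≡ deg g s z
  r≡ = trans (∑-comm r) (∑∑-δ z (λ y x → A g y x * s x))
  c≡ : ∑∑ c ≡ 0
  c≡ = trans (∑∑-δδ z z (A g)) (A-irrefl g z)
  rearr : ∀ a b → (a + a + b) + (b + 0) ≡ (a + b) + (a + b)
  rearr = solve-∀

del : GraphOn (suc m) → Fin (suc m) → GraphOn m
del g v = record
  { edge        = λ x y → edge g (punchIn v x) (punchIn v y)
  ; edge-sym    = λ x y → edge-sym g (punchIn v x) (punchIn v y)
  ; edge-irrefl = λ x → edge-irrefl g (punchIn v x)
  }

sum-del : (v : Fin (suc m)) (f : Fin (suc m) → ℕ) → f v ≡ 0 → sum f ≡ sum (f ∘ punchIn v)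
sum-del v f fv≡0 = trans (sum-remove {i = v} f) (cong (_+ sum (f ∘ punchIn v)) fv≡0)

E-del : (g : GraphOn (suc m)) (v : Fin (suc m)) (s : Fin (suc m) → ℕ) → s v ≡ 0 →
  E (del g v) (s ∘ punchIn v) ≡ E g s
E-del {m} g v s sv≡0 = double-cancel-≡ (begin
  E (del g v) (s ∘ punchIn v) + E (del g v) (s ∘ punchIn v) ≡⟨ E-double (del g v) (s ∘ punchIn v) ⟩
  Q (del g v) (s ∘ punchIn v)                      ≡⟨ sum-cong-≗ (λ x → sum-del v (q (punchIn v x)) (col0 (punchIn v x))) ⟨
  sum (λ x → sum (q (punchIn v x)))                ≡⟨ sum-del v (λ x → sum (q x)) row0 ⟨
  Q g s                                            ≡⟨ E-double g s ⟨
  E g s + E g s                                    ∎)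
  where
  open ≡-Reasoning
  q : Fin _ → Fin _ → ℕ
  q x y = s x * (A g x y * s y)
  col0 : ∀ x → q x v ≡ 0
  col0 x rewrite sv≡0 | *-zeroʳ (A g x v) = *-zeroʳ (s x)
  row0 : sum (q v) ≡ 0
  row0 rewrite sv≡0 = sum-0 {m}

link : Fin m → Fin m → Fin m → Fin m → Bool
link a c x y = (eq a x ∧ eq c y) ∨ (eq c x ∧ eq a y)

T-link : {a c x y : Fin m} → T (link a c x y) → (a ≡ x × c ≡ y) ⊎ (c ≡ x × a ≡ y)
T-link {a = a} {c} {x} {y} t with a ≟ x | c ≟ y | c ≟ x | a ≟ y
... | yes p | yes q | _     | _     = inj₁ (p , q)
... | _     | _     | yes p | yes q = inj₂ (p , q)
... | yes _ | no _  | yes _ | no _  = ⊥-elim t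
... | yes _ | no _  | no _  | _     = ⊥-elim t
... | no _  | _     | yes _ | no _  = ⊥-elim t
... | no _  | _     | no _  | _     = ⊥-elim t

link-intro : (a c : Fin m) → T (link a c a c)
link-intro a c rewrite eq-refl a | eq-refl c = tt

add : (g : GraphOn m) (a c : Fin m) → a ≢ c → GraphOn m
add g a c a≢c = record
  { edge        = λ x y → edge g x y ∨ link a c x y
  ; edge-sym    = λ x y → cong₂ _∨_ (edge-sym g x y)
      (trans (∨-comm (eq a x ∧ eq c y) _) (cong₂ _∨_ (∧-comm (eq c x) _) (∧-comm (eq a x) _)))
  ; edge-irrefl = λ x → trans (cong (_∨ link a c x x) (edge-irrefl g x)) (irr x)
  }
  where
  irr : ∀ x → link a c x x ≡ false
  irr x = T⇔⇒≡ (λ t → [ (λ (p , q) → a≢c (trans p (≡.sym q))) , (λ (p , q) → a≢c (trans q (≡.sym p))) ]′ (T-link {a = a} {c} {x} {x} t)) λ ()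

module _ (g : GraphOn m) {a c : Fin m} (a≢c : a ≢ c) where

  ~-add⁺ : ∀ {x y} → g ⊢ x ~ y → add g a c a≢c ⊢ x ~ y
  ~-add⁺ t = Equivalence.from T-∨ (inj₁ t)

  ~-add-new : add g a c a≢c ⊢ a ~ c
  ~-add-new = Equivalence.from (T-∨ {edge g a c}) (inj₂ (link-intro a c))

  ~-add⁻ : ∀ {x y} → add g a c a≢c ⊢ x ~ y → g ⊢ x ~ y ⊎ (x ≡ a × y ≡ c) ⊎ (x ≡ c × y ≡ a)
  ~-add⁻ {x} {y} t with Equivalence.to (T-∨ {edge g x y}) t
  ... | inj₁ e = inj₁ e
  ... | inj₂ l with T-link {a = a} {c} {x} {y} l
  ...   | inj₁ (refl , refl) = inj₂ (inj₁ (refl , refl))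
  ...   | inj₂ (refl , refl) = inj₂ (inj₂ (refl , refl))

  A-add : ¬ g ⊢ a ~ c → ∀ x y → A (add g a c a≢c) x y ≡ A g x y + (δ a x * δ c y + δ c x * δ a y)
  A-add a≁c x y with edge g x y in e
  ... | true = ≡.sym (cong suc (cong₂ _+_ (zero₁ a c (λ { (refl , refl) → a≁c (Equivalence.from T-≡ e) }))
                                         (zero₁ c a (λ { (refl , refl) → a≁c (Equivalence.from T-≡ (trans (edge-sym g a c) e)) }))))
    where
    zero₁ : ∀ p q → ¬ (p ≡ x × q ≡ y) → δ p x * δ q y ≡ 0
    zero₁ p q h with p ≟ x | q ≟ y
    ... | yes p≡x | yes q≡y = ⊥-elim (h (p≡x , q≡y))
    ... | yes _   | no _    = refl
    ... | no _    | _       = refl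
  ... | false with a ≟ x | c ≟ y | c ≟ x | a ≟ y
  ...   | yes p | _     | yes q | _     = ⊥-elim (a≢c (trans p (≡.sym q)))
  ...   | yes _ | yes _ | no _  | _     = refl
  ...   | yes _ | no _  | no _  | _     = refl
  ...   | no _  | _     | yes _ | yes _ = refl
  ...   | no _  | _     | yes _ | no _  = refl
  ...   | no _  | _     | no _  | _     = refl

  deg-add : ¬ g ⊢ a ~ c → ∀ s x → deg (add g a c a≢c) s x ≡ deg g s x + (δ a x * s c + δ c x * s a)
  deg-add a≁c s x = begin
    deg (add g a c a≢c) s x
      ≡⟨ sum-cong-≗ (λ y → trans (cong (_* s y) (A-add a≁c x y)) (algebra (A g x y) (δ a x) (δ c y) (δ c x) (δ a y) (s y))) ⟩
    sum (λ y → A g x y * s y + (δ c y * (δ a x * s y) + δ a y * (δ c x * s y)))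
      ≡⟨ ∑-distrib-+ (λ y → A g x y * s y) (λ y → δ c y * (δ a x * s y) + δ a y * (δ c x * s y)) ⟩
    deg g s x + sum (λ y → δ c y * (δ a x * s y) + δ a y * (δ c x * s y))
      ≡⟨ cong (deg g s x +_) (∑-distrib-+ (λ y → δ c y * (δ a x * s y)) (λ y → δ a y * (δ c x * s y))) ⟩
    deg g s x + (sum (λ y → δ c y * (δ a x * s y)) + sum (λ y → δ a y * (δ c x * s y)))
      ≡⟨ cong₂ (λ p q → deg g s x + (p + q)) (sum-δ* c (λ y → δ a x * s y)) (sum-δ* a (λ y → δ c x * s y)) ⟩
    deg g s x + (δ a x * s c + δ c x * s a) ∎
    where
    open ≡-Reasoning
    algebra : ∀ e p q r t w → (e + (p * q + r * t)) * w ≡ e * w + (q * (p * w) + t * (r * w))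
    algebra = solve-∀

  E-add : ¬ g ⊢ a ~ c → ∀ s → E (add g a c a≢c) s ≡ E g s + s a * s c
  E-add a≁c s = double-cancel-≡ (begin
    E g′ s + E g′ s                                  ≡⟨ E-double g′ s ⟩
    Q g′ s                                           ≡⟨ ∑∑-cong (λ x y → trans (cong (λ z → s x * (z * s y)) (A-add a≁c x y))
                                                          (algebra (s x) (A g x y) (δ a x) (δ c y) (δ c x) (δ a y) (s y))) ⟩
    ∑∑ (λ x y → q x y + (l x y + r x y))             ≡⟨ ∑∑-+ q (λ x y → l x y + r x y) ⟩
    Q g s + ∑∑ (λ x y → l x y + r x y)               ≡⟨ cong₂ _+_ (≡.sym (E-double g s)) (∑∑-+ l r) ⟩
    E g s + E g s + (∑∑ l + ∑∑ r)                    ≡⟨ cong₂ (λ p q → E g s + E g s + (p + q)) (∑∑-δδ a c (λ x y → s x * s y)) (∑∑-δδ c a (λ x y → s x * s y)) ⟩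
    E g s + E g s + (s a * s c + s c * s a)          ≡⟨ rearr (E g s) (s a) (s c) ⟩
    (E g s + s a * s c) + (E g s + s a * s c)        ∎)
    where
    open ≡-Reasoning
    g′ = add g a c a≢c
    q l r : Fin _ → Fin _ → ℕ
    q x y = s x * (A g x y * s y)
    l x y = δ a x * (δ c y * (s x * s y))
    r x y = δ c x * (δ a y * (s x * s y))
    algebra : ∀ w e p q r t u → w * ((e + (p * q + r * t)) * u) ≡ w * (e * u) + (p * (q * (w * u)) + r * (t * (w * u)))
    algebra = solve-∀
    rearr : ∀ e x y → e + e + (x * y + y * x) ≡ (e + x * y) + (e + x * y)
    rearr = solve-∀

size : (Fin m → Bool) → ℕ
size S = sum (𝟙 ∘ S)

-- Sparsity is asked of vertex sets only: among the subgraphs on a given vertex set the induced one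
-- has the most edges.
record Laman (g : GraphOn m) : Set where
  field
    total  : E g 1s + 3 ≡ 2 * m
    sparse : ∀ S → 2 ≤ size S → E g (𝟙 ∘ S) + 3 ≤ 2 * size S
open Laman

numEdges≡E : (g : GraphOn m) → numEdges (graph g) ≡ E g 1s
numEdges≡E {m} g = double-cancel-≡ (trans (countPairs-double (edge g) (edge-sym g) (edge-irrefl g))
  (≡.sym (trans (E-double g 1s) (∑∑-cong {m} λ x y → trans (*-identityˡ (A g x y * 1)) (*-identityʳ (A g x y))))))

induced : (g : GraphOn m) → (Fin m → Bool) → Subgraph (graph g)
induced g S = record
  { S = S
  ; F = λ x y → S x ∧ (edge g x y ∧ S y)
  ; F-sym = λ x y → symm (S x) (S y) (edge-sym g x y)
  ; F-sub = λ x y t → let (p , r) = Equivalence.to T-∧ t ; (q , s) = Equivalence.to (T-∧ {edge g x y}) r in q , p , s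
  }
  where
  symm : ∀ p q {e f} → e ≡ f → p ∧ (e ∧ q) ≡ q ∧ (f ∧ p)
  symm true  true  refl = refl
  symm false false refl = refl
  symm true  false {true} refl = refl
  symm true  false {false} refl = refl
  symm false true {true} refl = refl
  symm false true {false} refl = refl

toLaman : (g : GraphOn m) → IsLaman (graph g) → Laman g
toLaman g (total , sparse) = record
  { total  = trans (cong (_+ 3) (≡.sym (numEdges≡E g))) total
  ; sparse = λ S 2≤S → subst₂ _≤_ (cong (_+ 3) (edges S)) (cong (2 *_) (count≡sum S))
      (sparse (induced g S) (subst (2 ≤_) (≡.sym (count≡sum S)) 2≤S))
  }
  where
  edges : ∀ S → countPairs (F (induced g S)) ≡ E g (𝟙 ∘ S)
  edges S = double-cancel-≡ (trans
    (countPairs-double (F (induced g S)) (F-sym (induced g S)) (λ x → T⇔⇒≡ (λ t → ~⇒≢ g (proj₁ (F-sub (induced g S) x x t)) refl) λ ()))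
    (≡.sym (trans (E-double g (𝟙 ∘ S)) (∑∑-cong λ x y →
      ≡.sym (trans (𝟙-∧ (S x) _) (cong (𝟙 (S x) *_) (𝟙-∧ (edge g x y) _)))))))

fromLaman : (g : GraphOn m) → Laman g → IsLaman (graph g)
fromLaman g L = trans (cong (_+ 3) (numEdges≡E g)) (total L) , λ H 2≤H →
  ≤-trans (+-monoˡ-≤ 3 (edges H)) (subst (λ k → E g (𝟙 ∘ S H) + 3 ≤ 2 * k) (≡.sym (count≡sum (S H)))
    (sparse L (S H) (subst (2 ≤_) (count≡sum (S H)) 2≤H)))
  where
  bound : ∀ {f s e t} → (T f → T e × T s × T t) → 𝟙 f ≤ 𝟙 s * (𝟙 e * 𝟙 t)
  bound {false} _ = z≤n
  bound {true} {s} {e} {t} h with s | e | t | h tt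
  ... | true | true | true | _ = s≤s z≤n
  edges : ∀ H → countPairs (F H) ≤ E g (𝟙 ∘ S H)
  edges H = double-cancel-≤ (subst₂ _≤_
    (≡.sym (countPairs-double (F H) (F-sym H) (λ x → T⇔⇒≡ (λ t → ~⇒≢ g (proj₁ (F-sub H x x t)) refl) λ ())))
    (≡.sym (E-double g (𝟙 ∘ S H)))
    (∑∑-mono λ x y → bound (F-sub H x y)))

-- Neighbourhoods and tight sets

nonempty : (p : Fin m → Bool) → 1 ≤ size p → ∃ λ x → T (p x)
nonempty {suc m} p 1≤ with p zero in e
... | true  = zero , Equivalence.from T-≡ e
... | false = let (x , t) = nonempty (p ∘ suc) 1≤ in suc x , t

empty : (p : Fin m → Bool) → size p ≡ 0 → ∀ x → ¬ T (p x)
empty p p≡0 x t with ≤-trans (≤-reflexive (≡.sym (𝟙-T t))) (≤-sum (𝟙 ∘ p) x)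
... | 1≤ rewrite p≡0 = contradiction 1≤ λ ()

infixl 20 _∖_
_∖_ : (Fin m → Bool) → Fin m → Fin m → Bool
(p ∖ x) y = p y ∧ not (eq x y)

∖⁻ : (p : Fin m → Bool) {x y : Fin m} → T ((p ∖ x) y) → T (p y) × x ≢ y
∖⁻ p {x} {y} t with p y | x ≟ y
... | true | no x≢y = tt , x≢y

∖⁺ : (p : Fin m → Bool) {x y : Fin m} → T (p y) → x ≢ y → T ((p ∖ x) y)
∖⁺ p {x} {y} t x≢y with p y | x ≟ y
... | true | no _  = tt
... | true | yes e = x≢y e

𝟙-∖ : (p : Fin m → Bool) {x : Fin m} → T (p x) → ∀ y → 𝟙 (p y) ≡ 𝟙 ((p ∖ x) y) + δ x y
𝟙-∖ p {x} t y with x ≟ y | p y in e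
... | yes refl | true  = refl
... | yes refl | false = ⊥-elim (subst T e t)
... | no _     | true  = refl
... | no _     | false = refl

size-∖ : (p : Fin m → Bool) {x : Fin m} → T (p x) → size p ≡ suc (size (p ∖ x))
size-∖ p {x} t = begin
  size p                     ≡⟨ sum-cong-≗ (𝟙-∖ p t) ⟩
  sum (λ y → 𝟙 ((p ∖ x) y) + δ x y) ≡⟨ ∑-distrib-+ (𝟙 ∘ (p ∖ x)) (δ x) ⟩
  size (p ∖ x) + sum (δ x)   ≡⟨ cong (size (p ∖ x) +_) (sum-δ x) ⟩
  size (p ∖ x) + 1           ≡⟨ +-comm _ 1 ⟩
  suc (size (p ∖ x))         ∎
  where open ≡-Reasoning

peel : (p : Fin m → Bool) → ∀ {x} → T (p x) → size p ≡ suc k → size (p ∖ x) ≡ k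
peel p t e = suc-injective (trans (≡.sym (size-∖ p t)) e)

size-∖-≤ : (p : Fin m → Bool) (x : Fin m) → suc k ≤ size p → k ≤ size (p ∖ x)
size-∖-≤ {k = k} p x h = +-cancelʳ-≤ 1 k _ (begin
  k + 1                       ≡⟨ +-comm k 1 ⟩
  suc k                       ≤⟨ h ⟩
  size p                      ≤⟨ sum-mono bound ⟩
  sum (λ y → 𝟙 ((p ∖ x) y) + δ x y) ≡⟨ ∑-distrib-+ (𝟙 ∘ (p ∖ x)) (δ x) ⟩
  size (p ∖ x) + sum (δ x)    ≡⟨ cong (size (p ∖ x) +_) (sum-δ x) ⟩
  size (p ∖ x) + 1            ∎)
  where
  open ≤-Reasoning
  bound : ∀ y → 𝟙 (p y) ≤ 𝟙 ((p ∖ x) y) + δ x y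
  bound y with p y | x ≟ y
  ... | true  | yes _ = s≤s z≤n
  ... | true  | no _  = s≤s z≤n
  ... | false | _     = z≤n

d : GraphOn m → Fin m → ℕ
d g v = size (edge g v)

degree≡d : (g : GraphOn m) (v : Fin m) → degree (graph g) v ≡ d g v
degree≡d g v = count≡sum (edge g v)

deg-1s : (g : GraphOn m) (v : Fin m) → deg g 1s v ≡ d g v
deg-1s g v = sum-cong-≗ λ y → *-identityʳ (A g v y)

record N2 (g : GraphOn m) (v a b : Fin m) : Set where
  constructor n2
  field
    a≢b : a ≢ b
    v~a : g ⊢ v ~ a
    v~b : g ⊢ v ~ b
    only : ∀ {y} → g ⊢ v ~ y → y ≡ a ⊎ y ≡ b

record N3 (g : GraphOn m) (v a b c : Fin m) : Set where
  constructor n3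
  field
    a≢b : a ≢ b
    a≢c : a ≢ c
    b≢c : b ≢ c
    v~a : g ⊢ v ~ a
    v~b : g ⊢ v ~ b
    v~c : g ⊢ v ~ c
    only : ∀ {y} → g ⊢ v ~ y → y ≡ a ⊎ y ≡ b ⊎ y ≡ c

N3-swap : {g : GraphOn m} → ∀ {v a b c} → N3 g v a b c → N3 g v b a c
N3-swap (n3 p q r s t u o) = n3 (p ∘ ≡.sym) r q t s u λ e → sw (o e)
  where
  sw : ∀ {P R U : Set} → P ⊎ R ⊎ U → R ⊎ P ⊎ U
  sw = [ inj₂ ∘ inj₁ , [ inj₁ , inj₂ ∘ inj₂ ]′ ]′

other : (p : Fin m → Bool) (x : Fin m) → 2 ≤ size p → ∃ λ y → T (p y) × x ≢ y
other p x h = let (y , t) = nonempty (p ∖ x) (size-∖-≤ p x h) in y , ∖⁻ p t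

degree-2 : (g : GraphOn m) (v : Fin m) → d g v ≡ 2 → ∃[ a ] ∃[ b ] N2 g v a b
degree-2 g v dv≡2 with nonempty (edge g v) (≤-trans (s≤s z≤n) (≤-reflexive (≡.sym dv≡2)))
... | a , v~a with peel (edge g v) v~a dv≡2
...   | e₁ with nonempty (edge g v ∖ a) (≤-reflexive (≡.sym e₁))
...     | b , t with ∖⁻ (edge g v) t | peel (edge g v ∖ a) t e₁
...       | v~b , a≢b | e₂ = a , b , n2 a≢b v~a v~b only
  where
  only : ∀ {y} → g ⊢ v ~ y → y ≡ a ⊎ y ≡ b
  only {y} v~y with a ≟ y | b ≟ y
  ... | yes refl | _ = inj₁ refl
  ... | no _ | yes refl = inj₂ refl
  ... | no a≢y | no b≢y = ⊥-elim (empty _ e₂ y (∖⁺ (edge g v ∖ a) (∖⁺ (edge g v) v~y a≢y) b≢y))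

third-neighbour : (g : GraphOn m) {v a b : Fin m} → d g v ≡ 3 → g ⊢ v ~ a → g ⊢ v ~ b → a ≢ b → ∃[ c ] N3 g v a b c
third-neighbour g {v} {a} {b} dv≡3 v~a v~b a≢b with peel (edge g v) v~a dv≡3
... | e₁ with peel (edge g v ∖ a) (∖⁺ (edge g v) v~b a≢b) e₁
...   | e₂ with nonempty (edge g v ∖ a ∖ b) (≤-reflexive (≡.sym e₂))
...     | c , t with ∖⁻ (edge g v ∖ a) t | peel (edge g v ∖ a ∖ b) t e₂
...       | t′ , b≢c | e₃ with ∖⁻ (edge g v) t′
...         | v~c , a≢c = c , n3 a≢b a≢c b≢c v~a v~b v~c only
  where
  only : ∀ {y} → g ⊢ v ~ y → y ≡ a ⊎ y ≡ b ⊎ y ≡ c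
  only {y} v~y with a ≟ y | b ≟ y | c ≟ y
  ... | yes refl | _ | _ = inj₁ refl
  ... | no _ | yes refl | _ = inj₂ (inj₁ refl)
  ... | no _ | no _ | yes refl = inj₂ (inj₂ refl)
  ... | no a≢y | no b≢y | no c≢y = ⊥-elim (empty _ e₃ y
        (∖⁺ (edge g v ∖ a ∖ b) (∖⁺ (edge g v ∖ a) (∖⁺ (edge g v) v~y a≢y) b≢y) c≢y))

N2-A : (g : GraphOn m) {v a b : Fin m} → N2 g v a b → ∀ y → A g v y ≡ δ a y + δ b y
N2-A g {v} {a} {b} (n2 a≢b v~a v~b only) y with a ≟ y | b ≟ y
... | yes p    | yes q    = ⊥-elim (a≢b (trans p (≡.sym q)))
... | yes refl | no _     = 𝟙-T v~a
... | no _     | yes refl = 𝟙-T v~b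
... | no p     | no q     = 𝟙-F λ t → [ p ∘ ≡.sym , q ∘ ≡.sym ]′ (only t)

N3-A : (g : GraphOn m) {v a b c : Fin m} → N3 g v a b c → ∀ y → A g v y ≡ δ a y + δ b y + δ c y
N3-A g {v} {a} {b} {c} (n3 a≢b a≢c b≢c v~a v~b v~c only) y with a ≟ y | b ≟ y | c ≟ y
... | yes p    | yes q    | _        = ⊥-elim (a≢b (trans p (≡.sym q)))
... | yes p    | no _     | yes r    = ⊥-elim (a≢c (trans p (≡.sym r)))
... | no _     | yes q    | yes r    = ⊥-elim (b≢c (trans q (≡.sym r)))
... | yes refl | no _     | no _     = 𝟙-T v~a
... | no _     | yes refl | no _     = 𝟙-T v~b
... | no _     | no _     | yes refl = 𝟙-T v~c
... | no p     | no q     | no r     = 𝟙-F λ t → [ p ∘ ≡.sym , [ q ∘ ≡.sym , r ∘ ≡.sym ]′ ]′ (only t)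

deg-N2 : (g : GraphOn m) {v a b : Fin m} → N2 g v a b → ∀ s → deg g s v ≡ s a + s b
deg-N2 g {v} {a} {b} N s = begin
  deg g s v                                 ≡⟨ sum-cong-≗ (λ y → trans (cong (_* s y) (N2-A g N y)) (*-distribʳ-+ (s y) (δ a y) (δ b y))) ⟩
  sum (λ y → δ a y * s y + δ b y * s y)     ≡⟨ ∑-distrib-+ (λ y → δ a y * s y) (λ y → δ b y * s y) ⟩
  _                                         ≡⟨ cong₂ _+_ (sum-δ* a s) (sum-δ* b s) ⟩
  s a + s b                                 ∎
  where open ≡-Reasoning

deg-N3 : (g : GraphOn m) {v a b c : Fin m} → N3 g v a b c → ∀ s → deg g s v ≡ s a + s b + s c
deg-N3 g {v} {a} {b} {c} N s = begin
  deg g s v                                                 ≡⟨ sum-cong-≗ (λ y → trans (cong (_* s y) (N3-A g N y)) (algebra (δ a y) (δ b y) (δ c y) (s y))) ⟩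
  sum (λ y → δ a y * s y + δ b y * s y + δ c y * s y)       ≡⟨ ∑-distrib-+ (λ y → δ a y * s y + δ b y * s y) (λ y → δ c y * s y) ⟩
  sum (λ y → δ a y * s y + δ b y * s y) + sum (λ y → δ c y * s y) ≡⟨ cong (_+ sum (λ y → δ c y * s y)) (∑-distrib-+ (λ y → δ a y * s y) (λ y → δ b y * s y)) ⟩
  _                                                         ≡⟨ cong₂ _+_ (cong₂ _+_ (sum-δ* a s) (sum-δ* b s)) (sum-δ* c s) ⟩
  s a + s b + s c                                           ∎
  where
  open ≡-Reasoning
  algebra : ∀ p q r t → (p + q + r) * t ≡ p * t + q * t + r * t
  algebra = solve-∀

deg-≥2 : (g : GraphOn m) (S : Fin m → Bool) {z a b : Fin m} → a ≢ b →
  g ⊢ z ~ a → g ⊢ z ~ b → T (S a) → T (S b) → 2 ≤ deg g (𝟙 ∘ S) z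
deg-≥2 g S {z} {a} {b} a≢b z~a z~b Sa Sb = begin
  2                             ≡⟨ cong₂ _+_ (sum-δ a) (sum-δ b) ⟨
  sum (δ a) + sum (δ b)         ≡⟨ ∑-distrib-+ (δ a) (δ b) ⟨
  sum (λ y → δ a y + δ b y)     ≤⟨ sum-mono bound ⟩
  deg g (𝟙 ∘ S) z               ∎
  where
  open ≤-Reasoning
  bound : ∀ y → δ a y + δ b y ≤ A g z y * 𝟙 (S y)
  bound y with a ≟ y | b ≟ y
  ... | yes p    | yes q = ⊥-elim (a≢b (trans p (≡.sym q)))
  ... | yes refl | no _  = ≤-reflexive (≡.sym (cong₂ _*_ (𝟙-T z~a) (𝟙-T Sa)))
  ... | no _ | yes refl  = ≤-reflexive (≡.sym (cong₂ _*_ (𝟙-T z~b) (𝟙-T Sb)))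
  ... | no _     | no _  = z≤n

_⊕_ : (Fin m → Bool) → Fin m → Fin m → Bool
(S ⊕ z) y = S y ∨ eq z y

⊕-old : (S : Fin m → Bool) {z y : Fin m} → T (S y) → T ((S ⊕ z) y)
⊕-old S t = Equivalence.from T-∨ (inj₁ t)

⊕-new : (S : Fin m → Bool) {z : Fin m} → T ((S ⊕ z) z)
⊕-new S {z} = Equivalence.from (T-∨ {S z}) (inj₂ (≡⇒T-eq {x = z} refl))

⊕⁻ : (S : Fin m → Bool) {z y : Fin m} → T ((S ⊕ z) y) → T (S y) ⊎ z ≡ y
⊕⁻ S {z} {y} t = [ inj₁ , inj₂ ∘ T-eq⇒≡ ]′ (Equivalence.to (T-∨ {S y}) t)

module _ (S : Fin m → Bool) {z : Fin m} (z∉S : ¬ T (S z)) where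

  𝟙-⊕ : ∀ y → 𝟙 ((S ⊕ z) y) ≡ 𝟙 (S y) + δ z y
  𝟙-⊕ y with z ≟ y | S y in e
  ... | yes refl | true  = ⊥-elim (z∉S (Equivalence.from T-≡ e))
  ... | yes refl | false = refl
  ... | no _     | true  = refl
  ... | no _     | false = refl

  size-⊕ : size (S ⊕ z) ≡ suc (size S)
  size-⊕ = begin
    size (S ⊕ z)                  ≡⟨ sum-cong-≗ 𝟙-⊕ ⟩
    sum (λ y → 𝟙 (S y) + δ z y)   ≡⟨ ∑-distrib-+ (𝟙 ∘ S) (δ z) ⟩
    size S + sum (δ z)            ≡⟨ cong (size S +_) (sum-δ z) ⟩
    size S + 1                    ≡⟨ +-comm _ 1 ⟩
    suc (size S)                  ∎
    where open ≡-Reasoning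

  E-⊕ : (g : GraphOn m) → E g (𝟙 ∘ (S ⊕ z)) ≡ E g (𝟙 ∘ S) + deg g (𝟙 ∘ S) z
  E-⊕ g = trans (E-cong g 𝟙-⊕) (E-insert g (𝟙 ∘ S) z)

-- The inequality opposite to `sparse`; in a Laman graph it means equality as soon as `S` has two
-- vertices, while smaller sets satisfy it trivially.
Tight : GraphOn m → (Fin m → Bool) → Set
Tight g S = 2 * size S ≤ E g (𝟙 ∘ S) + 3

tight-⊕ : (g : GraphOn m) (S : Fin m → Bool) {z : Fin m} → ¬ T (S z) →
  Tight g S → 2 ≤ deg g (𝟙 ∘ S) z → Tight g (S ⊕ z)
tight-⊕ g S {z} z∉S tight 2≤d = begin
  2 * size (S ⊕ z)                              ≡⟨ cong (2 *_) (size-⊕ S z∉S) ⟩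
  2 * suc (size S)                              ≡⟨ a₁ (size S) ⟩
  2 * size S + 2                                ≤⟨ +-mono-≤ tight 2≤d ⟩
  E g (𝟙 ∘ S) + 3 + deg g (𝟙 ∘ S) z             ≡⟨ a₂ (E g (𝟙 ∘ S)) (deg g (𝟙 ∘ S) z) ⟩
  E g (𝟙 ∘ S) + deg g (𝟙 ∘ S) z + 3             ≡⟨ cong (_+ 3) (E-⊕ S z∉S g) ⟨
  E g (𝟙 ∘ (S ⊕ z)) + 3                         ∎
  where
  open ≤-Reasoning
  a₁ : ∀ x → 2 * suc x ≡ 2 * x + 2
  a₁ = solve-∀
  a₂ : ∀ x y → x + 3 + y ≡ x + y + 3
  a₂ = solve-∀

-- Adding `z` raises the bound 2|S| - 3 by 2 and the edge count by the number of neighbours of `z`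
-- in `S`; a tight set has no slack to pay for a third one.
tight⇒deg≤2 : (g : GraphOn m) → Laman g → (S : Fin m → Bool) {z : Fin m} → ¬ T (S z) →
  1 ≤ size S → Tight g S → deg g (𝟙 ∘ S) z ≤ 2
tight⇒deg≤2 g L S {z} z∉S 1≤S tight = +-cancelˡ-≤ (2 * size S) _ _ (begin
  2 * size S + deg g (𝟙 ∘ S) z                  ≤⟨ +-monoˡ-≤ _ tight ⟩
  E g (𝟙 ∘ S) + 3 + deg g (𝟙 ∘ S) z             ≡⟨ a₂ (E g (𝟙 ∘ S)) (deg g (𝟙 ∘ S) z) ⟩
  E g (𝟙 ∘ S) + deg g (𝟙 ∘ S) z + 3             ≡⟨ cong (_+ 3) (E-⊕ S z∉S g) ⟨
  E g (𝟙 ∘ (S ⊕ z)) + 3                         ≤⟨ sparse L (S ⊕ z) (subst (2 ≤_) (≡.sym (size-⊕ S z∉S)) (s≤s 1≤S)) ⟩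
  2 * size (S ⊕ z)                              ≡⟨ cong (2 *_) (size-⊕ S z∉S) ⟩
  2 * suc (size S)                              ≡⟨ a₁ (size S) ⟩
  2 * size S + 2                                ∎)
  where
  open ≤-Reasoning
  a₁ : ∀ x → 2 * suc x ≡ 2 * x + 2
  a₁ = solve-∀
  a₂ : ∀ x y → x + 3 + y ≡ x + y + 3
  a₂ = solve-∀

-- Triangle-connected Laman graphs

triangle-adj : (G : Graph) {x y a b c : Fin (n G)} → IsTriangle G a b c →
  x ∈₃ (a , b , c) → y ∈₃ (a , b , c) → x ≢ y → Adj G x y
triangle-adj G {a = a} {b} {c} (ab , bc , ac) = go
  where
  flip : ∀ {x y} → Adj G x y → Adj G y x
  flip {x} {y} = subst T (Graph.sym G x y)
  go : ∀ {x y} → x ∈₃ (a , b , c) → y ∈₃ (a , b , c) → x ≢ y → Adj G x y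
  go (inj₁ refl)        (inj₁ refl)        x≢y = contradiction refl x≢y
  go (inj₁ refl)        (inj₂ (inj₁ refl)) _   = ab
  go (inj₁ refl)        (inj₂ (inj₂ refl)) _   = ac
  go (inj₂ (inj₁ refl)) (inj₁ refl)        _   = flip ab
  go (inj₂ (inj₁ refl)) (inj₂ (inj₁ refl)) x≢y = contradiction refl x≢y
  go (inj₂ (inj₁ refl)) (inj₂ (inj₂ refl)) _   = bc
  go (inj₂ (inj₂ refl)) (inj₁ refl)        _   = flip ac
  go (inj₂ (inj₂ refl)) (inj₂ (inj₁ refl)) _   = flip bc
  go (inj₂ (inj₂ refl)) (inj₂ (inj₂ refl)) x≢y = contradiction refl x≢y

module _ (g : GraphOn m) where

  private G = graph g

  toEdge : ∀ {x y} → g ⊢ x ~ y →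
    Σ (Edge G) λ e → (proj₁ e ≡ (x , y)) ⊎ (proj₁ e ≡ (y , x))
  toEdge {x} {y} t with <-cmp x y
  ... | tri< p _ _    = ((x , y) , p , t) , inj₁ refl
  ... | tri≈ _ refl _ = ⊥-elim (~⇒≢ g t refl)
  ... | tri> _ _ q    = ((y , x) , q , ~-sym g t) , inj₂ refl

  Inside : (Fin m → Bool) → Edge G → Set
  Inside S ((x , y) , _) = T (S x) × T (S y)

  inside? : ∀ S e → Dec (Inside S e)
  inside? S ((x , y) , _) with S x | S y
  ... | true  | true  = yes (tt , tt)
  ... | true  | false = no proj₂
  ... | false | _     = no proj₁

  Apex : (Fin m → Bool) → Set
  Apex S = ∃[ z ] ∃[ p ] ∃[ q ] (¬ T (S z) × T (S p) × T (S q) × p ≢ q × g ⊢ z ~ p × g ⊢ z ~ q)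

  -- Along the chain of triangles, consider the first one that contains an edge leaving `S`. It also
  -- contains an edge inside `S`, so its remaining vertex is the apex over that edge.
  crossing : ∀ S {e₁ e₂} → Star (TriRel G) e₁ e₂ → Inside S e₁ → ¬ Inside S e₂ → Apex S
  crossing S ε i o = contradiction i o
  crossing S (_◅_ {j = e} (a , b , c , tri , (x∈ , y∈) , u∈ , w∈) rest) (Sx , Sy) o with inside? S e
  ... | yes i = crossing S rest i o
  crossing S {e₁ = (x , y) , lt , _} (_◅_ {j = (u , w) , _} (a , b , c , tri , (x∈ , y∈) , u∈ , w∈) rest) (Sx , Sy) o
    | no ¬i = apex
    where
    from : ∀ {z} → z ∈₃ (a , b , c) → ¬ T (S z) → Apex S
    from {z} z∈ z∉S = z , x , y , z∉S , Sx , Sy , (λ { refl → <-irrefl refl lt }) ,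
      triangle-adj G tri z∈ x∈ (λ { refl → z∉S Sx }) , triangle-adj G tri z∈ y∈ (λ { refl → z∉S Sy })
    apex : Apex S
    apex with T? (S u) | T? (S w)
    ... | no ¬Su | _      = from u∈ ¬Su
    ... | yes _  | no ¬Sw = from w∈ ¬Sw
    ... | yes Su | yes Sw = contradiction (Su , Sw) ¬i

  deg-eq : ∀ w z → deg g (𝟙 ∘ eq w) z ≡ A g z w
  deg-eq w z = trans (sum-cong-≗ (λ y → *-comm (A g z y) (δ w y))) (sum-δ* w (A g z))

  E-eq : ∀ w → E g (𝟙 ∘ eq w) ≡ 0
  E-eq w = double-cancel-≡ (trans (E-double g (δ w)) (trans (∑∑-δ w (λ x y → A g x y * δ w y))
    (trans (deg-eq w w) (A-irrefl g w))))

  -- In a triangle-connected Laman graph one can start from any edge and repeatedly attach, along an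
  -- edge, a triangle with one new vertex; sparsity forces the new vertex to have only two
  -- neighbours in the part already built, so the last vertex attached has degree 2.
  module _ (L : Laman g) (tc : TriConnected G) {w : Fin m} (deg≥3 : ∀ z → z ≢ w → 3 ≤ d g z) where

    -- Induction on the number `k` of vertices outside `S`. The vertex `z` is the last one attached
    -- and `z y` is an edge inside `S`, from which a chain of triangles leads to an edge at some
    -- outside vertex `o`. Since `w` is in `S` from the start, neither `o` nor any attached vertex
    -- is `w`. At `k = 0` the bound on the neighbours of `z` in `S` bounds its full degree.
    grow : ∀ k S {z y} → size (not ∘ S) ≡ k → Tight g S → 1 ≤ size S → T (S w) →
      T (S z) → z ≢ w → deg g (𝟙 ∘ S) z ≤ 2 → T (S y) → g ⊢ z ~ y → ⊥
    grow zero S {z} full tight 1≤S Sw Sz z≢w dz≤2 _ _ = <⇒≱ (deg≥3 z z≢w) (subst (_≤ 2) dz≡ dz≤2)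
      where
      S≗1 : 𝟙 ∘ S ≗ 1s
      S≗1 y with S y in e
      ... | true  = refl
      ... | false = ⊥-elim (empty (not ∘ S) full y (subst (T ∘ not) (≡.sym e) tt))
      dz≡ : deg g (𝟙 ∘ S) z ≡ d g z
      dz≡ = trans (sum-cong-≗ (λ y → cong (A g z y *_) (S≗1 y))) (deg-1s g z)
    grow (suc k) S {z} {y} co tight 1≤S Sw Sz z≢w dz≤2 Sy z~y = attach apex
      where
      outside = nonempty (not ∘ S) (≤-trans (s≤s z≤n) (≤-reflexive (≡.sym co)))
      o = proj₁ outside
      ¬So : ¬ T (S o)
      ¬So t with S o | proj₂ outside
      ... | true | ()
      o≢w : o ≢ w
      o≢w p = ¬So (subst (T ∘ S) (≡.sym p) Sw)
      o-nbr = nonempty (edge g o) (≤-trans (s≤s z≤n) (deg≥3 o o≢w))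
      inner = toEdge z~y
      outer = toEdge (proj₂ o-nbr)
      inner-in : Inside S (proj₁ inner)
      inner-in with inner
      ... | _ , inj₁ refl = Sz , Sy
      ... | _ , inj₂ refl = Sy , Sz
      outer-out : ¬ Inside S (proj₁ outer)
      outer-out with outer
      ... | _ , inj₁ refl = ¬So ∘ proj₁
      ... | _ , inj₂ refl = ¬So ∘ proj₂
      apex : Apex S
      apex = crossing S (tc (proj₁ inner) (proj₁ outer)) inner-in outer-out
      attach : Apex S → ⊥
      attach (c , p , q , c∉S , Sp , Sq , p≢q , c~p , c~q) =
        grow k (S ⊕ c) {c} {p} co′ (tight-⊕ g S c∉S tight (deg-≥2 g S p≢q c~p c~q Sp Sq))
          (≤-trans 1≤S (≤-trans (n≤1+n _) (≤-reflexive (≡.sym (size-⊕ S c∉S)))))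
          (⊕-old S {c} Sw) (⊕-new S) (λ { refl → c∉S Sw }) dc≤2 (⊕-old S {c} Sp) c~p
        where
        co′ : size (not ∘ (S ⊕ c)) ≡ k
        co′ = trans (sum-cong-≗ λ x → cong 𝟙 (de-morgan (S x) (eq c x))) (peel (not ∘ S) ¬Sc co)
          where
          de-morgan : ∀ a b → not (a ∨ b) ≡ not a ∧ not b
          de-morgan true  b = refl
          de-morgan false b = refl
          ¬Sc : T (not (S c))
          ¬Sc with S c
          ... | true  = c∉S tt
          ... | false = tt
        dc≤2 : deg g (𝟙 ∘ (S ⊕ c)) c ≤ 2
        dc≤2 = subst (_≤ 2) (≡.sym deg≡) (tight⇒deg≤2 g L S c∉S 1≤S tight)
          where
          deg≡ : deg g (𝟙 ∘ (S ⊕ c)) c ≡ deg g (𝟙 ∘ S) c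
          deg≡ = sum-cong-≗ pointwise
            where
            pointwise : ∀ x → A g c x * 𝟙 ((S ⊕ c) x) ≡ A g c x * 𝟙 (S x)
            pointwise x with c ≟ x
            ... | yes refl rewrite A-irrefl g c = refl
            ... | no _ = cong (A g c x *_) (cong 𝟙 (∨-identityʳ (S x)))

    -- Growing from an edge at the exceptional vertex `w` ensures that the last vertex attached, of
    -- degree at most 2, is a different one. The other end `u` counts as attached first, with one
    -- neighbour.
    triConnected⇒degree-2 : ∀ {u} → g ⊢ w ~ u → ⊥
    triConnected⇒degree-2 {u} w~u =
      grow _ W {u} {w} refl (≤-reflexive tight) (subst (1 ≤_) (≡.sym size≡) (s≤s z≤n))
        (Equivalence.from (T-∨ {eq w w}) (inj₁ (≡⇒T-eq {x = w} refl)))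
        (⊕-new (eq w)) (~⇒≢ g w~u ∘ ≡.sym)
        (≤-trans (≤-reflexive degu) (s≤s z≤n)) (Equivalence.from (T-∨ {eq w w}) (inj₁ (≡⇒T-eq {x = w} refl))) (~-sym g w~u)
      where
      W : Fin m → Bool
      W = eq w ⊕ u
      u∉ : ¬ T (eq w u)
      u∉ t = ~⇒≢ g w~u (T-eq⇒≡ t)
      size≡ : size W ≡ 2
      size≡ = trans (size-⊕ (eq w) u∉) (cong suc (sum-δ w))
      tight : 2 * size W ≡ E g (𝟙 ∘ W) + 3
      tight = begin
        2 * size W                             ≡⟨ cong (2 *_) size≡ ⟩
        4                                      ≡⟨ cong (_+ 3) (cong₂ _+_ (E-eq w) (trans (deg-eq w u) (𝟙-T (~-sym g w~u)))) ⟨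
        E g (𝟙 ∘ eq w) + deg g (𝟙 ∘ eq w) u + 3 ≡⟨ cong (_+ 3) (E-⊕ (eq w) u∉ g) ⟨
        E g (𝟙 ∘ W) + 3                        ∎
        where open ≡-Reasoning
      degu : deg g (𝟙 ∘ W) u ≡ 1
      degu = trans (sum-cong-≗ (λ y → trans (cong (A g u y *_) (𝟙-⊕ (eq w) u∉ y)) (*-distribˡ-+ (A g u y) (δ w y) (δ u y))))
        (trans (∑-distrib-+ (λ y → A g u y * δ w y) (λ y → A g u y * δ u y))
        (cong₂ _+_ (trans (deg-eq w u) (𝟙-T (~-sym g w~u)))
          (trans (sum-cong-≗ (λ y → *-comm (A g u y) (δ u y))) (trans (sum-δ* u (A g u)) (A-irrefl g u)))))

-- Deleting a vertex

unpunch : (v : Fin (suc m)) {x : Fin (suc m)} → v ≢ x → ∃ λ y → punchIn v y ≡ x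
unpunch v v≢x = punchOut v≢x , punchIn-punchOut v≢x

δ-punchIn : (v : Fin (suc m)) (a x : Fin m) → δ (punchIn v a) (punchIn v x) ≡ δ a x
δ-punchIn v a x with a ≟ x
... | yes refl = δ-refl (punchIn v a)
... | no a≢x   = δ-≢ (a≢x ∘ punchIn-injective v a x)

module _ (g : GraphOn (suc m)) (v : Fin (suc m)) where

  E-del-set : (S : Fin m → Bool) → E (del g v) (𝟙 ∘ S) ≡ E g (𝟙 ∘ insertAt S v false)
  E-del-set S = trans (E-cong (del g v) λ x → cong 𝟙 (≡.sym (insertAt-punchIn S v false x)))
    (E-del g v (𝟙 ∘ insertAt S v false) (cong 𝟙 (insertAt-lookup S v false)))

  size-insertAt : (S : Fin m → Bool) → size (insertAt S v false) ≡ size S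
  size-insertAt S = trans (sum-del v (𝟙 ∘ insertAt S v false) (cong 𝟙 (insertAt-lookup S v false)))
    (sum-cong-≗ λ x → cong 𝟙 (insertAt-punchIn S v false x))

  E-del-total : E g 1s ≡ E (del g v) 1s + d g v
  E-del-total = begin
    E g 1s                          ≡⟨ E-cong g split ⟩
    E g (λ x → r x + δ v x)         ≡⟨ E-insert g r v ⟩
    E g r + deg g r v               ≡⟨ cong₂ _+_ (≡.sym (E-del g v r (cong (𝟙 ∘ not) (eq-refl v)))) (sum-cong-≗ avoid) ⟩
    E (del g v) (r ∘ punchIn v) + d g v ≡⟨ cong (_+ d g v) (E-cong (del g v) rest) ⟩
    E (del g v) 1s + d g v          ∎
    where
    open ≡-Reasoning
    r : Fin (suc m) → ℕ
    r x = 𝟙 (not (eq v x))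
    split : ∀ x → 1 ≡ r x + δ v x
    split x with v ≟ x
    ... | yes _ = refl
    ... | no _  = refl
    avoid : ∀ y → A g v y * r y ≡ A g v y
    avoid y with v ≟ y
    ... | yes refl rewrite A-irrefl g v = refl
    ... | no _     = *-identityʳ _
    rest : ∀ x → r (punchIn v x) ≡ 1
    rest x rewrite dec-false (v ≟ punchIn v x) (punchInᵢ≢i v x ∘ ≡.sym) = refl

  d-del : ∀ x → d g (punchIn v x) ≡ A g v (punchIn v x) + d (del g v) x
  d-del x = trans (sum-remove {i = v} (A g (punchIn v x))) (cong (_+ d (del g v) x) (A-sym g (punchIn v x) v))

  del-laman : Laman g → d g v ≡ 2 → Laman (del g v)
  del-laman L dv≡2 = record
    { total  = +-cancelʳ-≡ 2 (E (del g v) 1s + 3) (2 * m) (begin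
        E (del g v) 1s + 3 + 2      ≡⟨ a₁ (E (del g v) 1s) ⟩
        E (del g v) 1s + 2 + 3      ≡⟨ cong (λ k → E (del g v) 1s + k + 3) dv≡2 ⟨
        E (del g v) 1s + d g v + 3  ≡⟨ cong (_+ 3) E-del-total ⟨
        E g 1s + 3                  ≡⟨ total L ⟩
        2 * suc m                   ≡⟨ a₂ m ⟩
        2 * m + 2                   ∎)
    ; sparse = λ S 2≤S → subst₂ _≤_ (cong (_+ 3) (≡.sym (E-del-set S))) (cong (2 *_) (size-insertAt S))
        (sparse L (insertAt S v false) (subst (2 ≤_) (≡.sym (size-insertAt S)) 2≤S))
    }
    where
    open ≡-Reasoning
    a₁ : ∀ x → x + 3 + 2 ≡ x + 2 + 3
    a₁ = solve-∀
    a₂ : ∀ x → 2 * suc x ≡ 2 * x + 2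
    a₂ = solve-∀

  module _ {a c : Fin m} (a≢c : a ≢ c) (a≁c : ¬ del g v ⊢ a ~ c) where

    del-add : GraphOn m
    del-add = add (del g v) a c a≢c

    d-del-add : ∀ x → d del-add x ≡ d (del g v) x + (δ a x + δ c x)
    d-del-add x = begin
      d del-add x                                            ≡⟨ deg-1s del-add x ⟨
      deg del-add 1s x                                       ≡⟨ deg-add (del g v) a≢c a≁c 1s x ⟩
      deg (del g v) 1s x + (δ a x * 1 + δ c x * 1)           ≡⟨ cong₂ _+_ (deg-1s (del g v) x) (cong₂ _+_ (*-identityʳ (δ a x)) (*-identityʳ (δ c x))) ⟩
      d (del g v) x + (δ a x + δ c x)                        ∎
      where open ≡-Reasoning

    -- Three edges are lost and one is gained, which fits the loss of one vertex. The new edge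
    -- raises the count only of sets containing both its ends, and `loose` grants exactly these sets
    -- one unit of slack.
    del-add-laman : Laman g → d g v ≡ 3 →
      (∀ S → ¬ T (S v) → T (S (punchIn v a)) → T (S (punchIn v c)) → ¬ Tight g S) →
      Laman del-add
    del-add-laman L dv≡3 loose = record
      { total  = +-cancelʳ-≡ 2 (E del-add 1s + 3) (2 * m) (begin
          E del-add 1s + 3 + 2            ≡⟨ cong (λ k → k + 3 + 2) (E-add (del g v) a≢c a≁c 1s) ⟩
          E (del g v) 1s + 1 + 3 + 2      ≡⟨ a₁ (E (del g v) 1s) ⟩
          E (del g v) 1s + 3 + 3          ≡⟨ cong (λ k → E (del g v) 1s + k + 3) dv≡3 ⟨
          E (del g v) 1s + d g v + 3      ≡⟨ cong (_+ 3) E-del-total ⟨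
          E g 1s + 3                      ≡⟨ total L ⟩
          2 * suc m                       ≡⟨ a₂ m ⟩
          2 * m + 2                       ∎)
      ; sparse = sparse′
      }
      where
      open ≡-Reasoning
      a₁ : ∀ x → x + 1 + 3 + 2 ≡ x + 3 + 3
      a₁ = solve-∀
      a₂ : ∀ x → 2 * suc x ≡ 2 * x + 2
      a₂ = solve-∀
      a₃ : ∀ x → x + 1 + 3 ≡ suc (x + 3)
      a₃ = solve-∀
      unchanged : ∀ S → 2 ≤ size S → 𝟙 (S a) * 𝟙 (S c) ≡ 0 → E (del g v) (𝟙 ∘ S) + 𝟙 (S a) * 𝟙 (S c) + 3 ≤ 2 * size S
      unchanged S 2≤S e rewrite e | +-identityʳ (E (del g v) (𝟙 ∘ S)) | E-del-set S | ≡.sym (size-insertAt S) =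
        sparse L (insertAt S v false) 2≤S
      bound : ∀ S → 2 ≤ size S → E (del g v) (𝟙 ∘ S) + 𝟙 (S a) * 𝟙 (S c) + 3 ≤ 2 * size S
      bound S 2≤S with T? (S a) | T? (S c)
      ... | no ¬Sa | _      = unchanged S 2≤S (cong (_* 𝟙 (S c)) (𝟙-F ¬Sa))
      ... | yes _  | no ¬Sc = unchanged S 2≤S (trans (cong (𝟙 (S a) *_) (𝟙-F ¬Sc)) (*-zeroʳ (𝟙 (S a))))
      ... | yes Sa | yes Sc = subst₂ _≤_ lhs (cong (2 *_) (size-insertAt S)) (≰⇒> (loose S′ (subst T (insertAt-lookup S v false))
            (subst T (≡.sym (insertAt-punchIn S v false a)) Sa) (subst T (≡.sym (insertAt-punchIn S v false c)) Sc)))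
        where
        S′ = insertAt S v false
        lhs : suc (E g (𝟙 ∘ S′) + 3) ≡ E (del g v) (𝟙 ∘ S) + 𝟙 (S a) * 𝟙 (S c) + 3
        lhs = begin
          suc (E g (𝟙 ∘ S′) + 3)                       ≡⟨ a₃ (E g (𝟙 ∘ S′)) ⟨
          E g (𝟙 ∘ S′) + 1 + 3                         ≡⟨ cong (λ k → k + 1 + 3) (E-del-set S) ⟨
          E (del g v) (𝟙 ∘ S) + 1 + 3                  ≡⟨ cong (λ k → E (del g v) (𝟙 ∘ S) + k + 3) (cong₂ _*_ (𝟙-T Sa) (𝟙-T Sc)) ⟨
          E (del g v) (𝟙 ∘ S) + 𝟙 (S a) * 𝟙 (S c) + 3  ∎
      sparse′ : ∀ S → 2 ≤ size S → E del-add (𝟙 ∘ S) + 3 ≤ 2 * size S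
      sparse′ S 2≤S = subst (λ k → k + 3 ≤ 2 * size S) (≡.sym (E-add (del g v) a≢c a≁c (𝟙 ∘ S))) (bound S 2≤S)

d-N3 : (g : GraphOn m) {v a b c : Fin m} → N3 g v a b c → d g v ≡ 3
d-N3 g {v} N = trans (≡.sym (deg-1s g v)) (deg-N3 g N 1s)

d-N2 : (g : GraphOn m) {v a b : Fin m} → N2 g v a b → d g v ≡ 2
d-N2 g {v} N = trans (≡.sym (deg-1s g v)) (deg-N2 g N 1s)

1≤size : (S : Fin m → Bool) {x : Fin m} → T (S x) → 1 ≤ size S
1≤size S {x} Sx = ≤-trans (≤-reflexive (≡.sym (𝟙-T Sx))) (≤-sum (𝟙 ∘ S) x)

-- Uncrossing tight sets

_∪_ _∩_ : (Fin m → Bool) → (Fin m → Bool) → Fin m → Bool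
(S₁ ∪ S₂) x = S₁ x ∨ S₂ x
(S₁ ∩ S₂) x = S₁ x ∧ S₂ x

size-∪-∩ : (S₁ S₂ : Fin m → Bool) → size (S₁ ∪ S₂) + size (S₁ ∩ S₂) ≡ size S₁ + size S₂
size-∪-∩ S₁ S₂ = trans (≡.sym (∑-distrib-+ (𝟙 ∘ (S₁ ∪ S₂)) (𝟙 ∘ (S₁ ∩ S₂))))
  (trans (sum-cong-≗ λ x → pointwise (S₁ x) (S₂ x)) (∑-distrib-+ (𝟙 ∘ S₁) (𝟙 ∘ S₂)))
  where
  pointwise : ∀ p q → 𝟙 (p ∨ q) + 𝟙 (p ∧ q) ≡ 𝟙 p + 𝟙 q
  pointwise true  true  = refl
  pointwise true  false = refl
  pointwise false q     = +-identityʳ _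

module _ (g : GraphOn m) (L : Laman g) where

  tight-N3-⊥ : ∀ {v a b c} → N3 g v a b c → (S : Fin m → Bool) → ¬ T (S v) → T (S a) → T (S b) → T (S c) → ¬ Tight g S
  tight-N3-⊥ {v} {a} {b} {c} N S v∉S Sa Sb Sc tight = <⇒≱ (≤-reflexive (≡.sym deg≡3)) (tight⇒deg≤2 g L S v∉S (1≤size S Sa) tight)
    where
    deg≡3 : deg g (𝟙 ∘ S) v ≡ 3
    deg≡3 = trans (deg-N3 g N (𝟙 ∘ S)) (cong₂ _+_ (cong₂ _+_ (𝟙-T Sa) (𝟙-T Sb)) (𝟙-T Sc))

  ⊕-∌ : (S : Fin m → Bool) {v b : Fin m} → ¬ T (S v) → b ≢ v → ¬ T ((S ⊕ b) v)
  ⊕-∌ S v∉S b≢v t = [ v∉S , b≢v ]′ (⊕⁻ S t)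

  -- A tight set containing `a` and `c` stays tight when their common neighbour `b` joins it, and
  -- then it contains all three neighbours of `v`.
  loose-two-pairs : ∀ {v a b c} → N3 g v a b c → g ⊢ b ~ a → g ⊢ b ~ c →
    (S : Fin m → Bool) → ¬ T (S v) → T (S a) → T (S c) → ¬ Tight g S
  loose-two-pairs {v} {a} {b} {c} N b~a b~c S v∉S Sa Sc tight with T? (S b)
  ... | yes Sb = tight-N3-⊥ N S v∉S Sa Sb Sc tight
  ... | no b∉S = tight-N3-⊥ N (S ⊕ b) (⊕-∌ S v∉S (~⇒≢ g (N3.v~b N) ∘ ≡.sym)) (⊕-old S {b} Sa) (⊕-new S) (⊕-old S {b} Sc)
        (tight-⊕ g S b∉S tight (deg-≥2 g S (N3.a≢c N) b~a b~c Sa Sc))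

  -- The constant is 2 instead of 3 so that a single vertex, which spans no edge, is covered: the
  -- intersection in `tight-∪` may consist of `b` alone.
  E-bound : ∀ S → 1 ≤ size S → E g (𝟙 ∘ S) + 2 ≤ 2 * size S
  E-bound S 1≤S with 2 ≤? size S
  ... | yes 2≤S = ≤-trans (+-monoʳ-≤ (E g (𝟙 ∘ S)) (n≤1+n 2)) (sparse L S 2≤S)
  ... | no 2≰S  = subst (_≤ 2 * size S) (≡.sym (cong (_+ 2) E≡0)) (*-monoʳ-≤ 2 1≤S)
    where
    b = proj₁ (nonempty S 1≤S)
    Sb = proj₂ (nonempty S 1≤S)
    size≡1 : size S ≡ 1
    size≡1 = ≤-antisym (≤-pred (≰⇒> 2≰S)) 1≤S
    E≡0 : E g (𝟙 ∘ S) ≡ 0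
    E≡0 = trans (E-cong g λ y → trans (𝟙-∖ S Sb y) (cong (_+ δ b y) (𝟙-F (empty (S ∖ b) (peel S Sb size≡1) y)))) (E-eq g b)

  -- The edge `c x` lies in the union but in neither of the two sets; it accounts for the extra 1.
  E-supermodular : ∀ S₁ S₂ {c x} → T (S₁ c) → ¬ T (S₂ c) → T (S₂ x) → ¬ T (S₁ x) → g ⊢ c ~ x →
    E g (𝟙 ∘ S₁) + E g (𝟙 ∘ S₂) + 1 ≤ E g (𝟙 ∘ (S₁ ∪ S₂)) + E g (𝟙 ∘ (S₁ ∩ S₂))
  E-supermodular S₁ S₂ {c} {x} c∈₁ c∉₂ x∈₂ x∉₁ c~x = double-cancel-≤ (begin
    (e₁ + e₂ + 1) + (e₁ + e₂ + 1)                      ≡⟨ a₁ e₁ e₂ ⟩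
    (e₁ + e₁) + (e₂ + e₂) + (1 + 1)                    ≡⟨ cong₂ _+_ (cong₂ _+_ (E-double g (𝟙 ∘ S₁)) (E-double g (𝟙 ∘ S₂)))
                                                           (cong₂ _+_ (≡.sym (trans (∑∑-δδ c x (A g)) (𝟙-T c~x))) (≡.sym (trans (∑∑-δδ x c (A g)) (𝟙-T (~-sym g c~x))))) ⟩
    (∑∑ q₁ + ∑∑ q₂) + (∑∑ l + ∑∑ r)                    ≡⟨ cong₂ _+_ (≡.sym (∑∑-+ q₁ q₂)) (≡.sym (∑∑-+ l r)) ⟩
    ∑∑ (λ y z → q₁ y z + q₂ y z) + ∑∑ (λ y z → l y z + r y z) ≡⟨ ∑∑-+ (λ y z → q₁ y z + q₂ y z) (λ y z → l y z + r y z) ⟨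
    ∑∑ (λ y z → (q₁ y z + q₂ y z) + (l y z + r y z))   ≤⟨ ∑∑-mono pointwise ⟩
    ∑∑ (λ y z → q∪ y z + q∩ y z)                       ≡⟨ ∑∑-+ q∪ q∩ ⟩
    ∑∑ q∪ + ∑∑ q∩                                      ≡⟨ cong₂ _+_ (≡.sym (E-double g (𝟙 ∘ (S₁ ∪ S₂)))) (≡.sym (E-double g (𝟙 ∘ (S₁ ∩ S₂)))) ⟩
    (e∪ + e∪) + (e∩ + e∩)                              ≡⟨ a₂ e∪ e∩ ⟩
    (e∪ + e∩) + (e∪ + e∩)                              ∎)
    where
    open ≤-Reasoning
    e₁ = E g (𝟙 ∘ S₁)
    e₂ = E g (𝟙 ∘ S₂)
    e∪ = E g (𝟙 ∘ (S₁ ∪ S₂))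
    e∩ = E g (𝟙 ∘ (S₁ ∩ S₂))
    q : (Fin m → Bool) → Fin m → Fin m → ℕ
    q U y z = 𝟙 (U y) * (A g y z * 𝟙 (U z))
    q₁ = q S₁
    q₂ = q S₂
    q∪ = q (S₁ ∪ S₂)
    q∩ = q (S₁ ∩ S₂)
    l r : Fin m → Fin m → ℕ
    l y z = δ c y * (δ x z * A g y z)
    r y z = δ x y * (δ c z * A g y z)
    a₁ : ∀ a b → (a + b + 1) + (a + b + 1) ≡ (a + a) + (b + b) + (1 + 1)
    a₁ = solve-∀
    a₂ : ∀ a b → (a + a) + (b + b) ≡ (a + b) + (a + b)
    a₂ = solve-∀
    only : (U V : Fin m → Bool) → ∀ {z} → T (U z) → ¬ T (V z) → ∀ y → δ z y ≤ 𝟙 (U y ∧ not (V y))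
    only U V {z} Uz ¬Vz y with z ≟ y
    ... | no _ = z≤n
    ... | yes refl with U z | V z
    ...   | true | true  = ⊥-elim (¬Vz tt)
    ...   | true | false = ≤-refl
    -- The defect of modularity is the number of edges between S₁ ∖ S₂ and S₂ ∖ S₁.
    split : ∀ p₁ p₂ a r₁ r₂ →
      (𝟙 p₁ * (a * 𝟙 r₁) + 𝟙 p₂ * (a * 𝟙 r₂))
        + (𝟙 (p₁ ∧ not p₂) * (𝟙 (r₂ ∧ not r₁) * a) + 𝟙 (p₂ ∧ not p₁) * (𝟙 (r₁ ∧ not r₂) * a))
      ≡ 𝟙 (p₁ ∨ p₂) * (a * 𝟙 (r₁ ∨ r₂)) + 𝟙 (p₁ ∧ p₂) * (a * 𝟙 (r₁ ∧ r₂))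
    split false false a r₁ r₂ = refl
    split false true  a false false = s₀ a
      where
      s₀ : ∀ a → 0 + 1 * (a * 0) + (0 + 1 * (0 * a)) ≡ 1 * (a * 0) + 0
      s₀ = solve-∀
    split false true  a false true  = s₀ a
      where
      s₀ : ∀ a → 0 + 1 * (a * 1) + (0 + 1 * (0 * a)) ≡ 1 * (a * 1) + 0
      s₀ = solve-∀
    split false true  a true  false = s₀ a
      where
      s₀ : ∀ a → 0 + 1 * (a * 0) + (0 + 1 * (1 * a)) ≡ 1 * (a * 1) + 0
      s₀ = solve-∀
    split false true  a true  true  = s₀ a
      where
      s₀ : ∀ a → 0 + 1 * (a * 1) + (0 + 1 * (0 * a)) ≡ 1 * (a * 1) + 0
      s₀ = solve-∀
    split true  false a false false = s₀ a
      where
      s₀ : ∀ a → 1 * (a * 0) + 0 + (1 * (0 * a) + 0) ≡ 1 * (a * 0) + 0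
      s₀ = solve-∀
    split true  false a false true  = s₀ a
      where
      s₀ : ∀ a → 1 * (a * 0) + 0 + (1 * (1 * a) + 0) ≡ 1 * (a * 1) + 0
      s₀ = solve-∀
    split true  false a true  false = s₀ a
      where
      s₀ : ∀ a → 1 * (a * 1) + 0 + (1 * (0 * a) + 0) ≡ 1 * (a * 1) + 0
      s₀ = solve-∀
    split true  false a true  true  = s₀ a
      where
      s₀ : ∀ a → 1 * (a * 1) + 0 + (1 * (0 * a) + 0) ≡ 1 * (a * 1) + 0
      s₀ = solve-∀
    split true  true  a false false = +-identityʳ _
    split true  true  a false true  = trans (+-identityʳ _) (+-comm (1 * (a * 0)) (1 * (a * 1)))
    split true  true  a true  false = +-identityʳ _
    split true  true  a true  true  = +-identityʳ _
    pointwise : ∀ y z → (q₁ y z + q₂ y z) + (l y z + r y z) ≤ q∪ y z + q∩ y z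
    pointwise y z = ≤-trans
      (+-monoʳ-≤ (q₁ y z + q₂ y z) (+-mono-≤
        (*-mono-≤ (only S₁ S₂ c∈₁ c∉₂ y) (*-monoˡ-≤ (A g y z) (only S₂ S₁ x∈₂ x∉₁ z)))
        (*-mono-≤ (only S₂ S₁ x∈₂ x∉₁ y) (*-monoˡ-≤ (A g y z) (only S₁ S₂ c∈₁ c∉₂ z)))))
      (≤-reflexive (split (S₁ y) (S₂ y) (A g y z) (S₁ z) (S₂ z)))

  -- The usual uncrossing wants two common vertices, so that the intersection obeys the bound with
  -- 3. Here only `b` is known to be common; the unit lost in `E-bound` is recovered from the edge
  -- `c x` between the two differences.
  tight-∪ : ∀ S₁ S₂ {b c x} → T (S₁ b) → T (S₂ b) → T (S₁ c) → ¬ T (S₂ c) → T (S₂ x) → ¬ T (S₁ x) → g ⊢ c ~ x →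
    Tight g S₁ → Tight g S₂ → Tight g (S₁ ∪ S₂)
  tight-∪ S₁ S₂ {b} b∈₁ b∈₂ c∈₁ c∉₂ x∈₂ x∉₁ c~x tight₁ tight₂ = +-cancelʳ-≤ (2 * s∩) _ _ (begin
    2 * s∪ + 2 * s∩              ≡⟨ a₁ s∪ s∩ ⟩
    2 * (s∪ + s∩)                ≡⟨ cong (2 *_) (size-∪-∩ S₁ S₂) ⟩
    2 * (size S₁ + size S₂)      ≡⟨ a₁ (size S₁) (size S₂) ⟨
    2 * size S₁ + 2 * size S₂    ≤⟨ +-mono-≤ tight₁ tight₂ ⟩
    e₁ + 3 + (e₂ + 3)            ≡⟨ a₂ e₁ e₂ ⟩
    (e₁ + e₂ + 1) + 5            ≤⟨ +-monoˡ-≤ 5 (E-supermodular S₁ S₂ c∈₁ c∉₂ x∈₂ x∉₁ c~x) ⟩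
    (e∪ + e∩) + 5                ≡⟨ a₃ e∪ e∩ ⟩
    (e∪ + 3) + (e∩ + 2)          ≤⟨ +-monoʳ-≤ (e∪ + 3) (E-bound (S₁ ∩ S₂) (1≤size (S₁ ∩ S₂) (Equivalence.from (T-∧ {S₁ b}) (b∈₁ , b∈₂)))) ⟩
    (e∪ + 3) + 2 * s∩            ∎)
    where
    open ≤-Reasoning
    s∪ = size (S₁ ∪ S₂)
    s∩ = size (S₁ ∩ S₂)
    e₁ = E g (𝟙 ∘ S₁)
    e₂ = E g (𝟙 ∘ S₂)
    e∪ = E g (𝟙 ∘ (S₁ ∪ S₂))
    e∩ = E g (𝟙 ∘ (S₁ ∩ S₂))
    a₁ : ∀ a b → 2 * a + 2 * b ≡ 2 * (a + b)
    a₁ = solve-∀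
    a₂ : ∀ a b → a + 3 + (b + 3) ≡ (a + b + 1) + 5
    a₂ = solve-∀
    a₃ : ∀ a b → (a + b) + 5 ≡ (a + 3) + (b + 2)
    a₃ = solve-∀

  module _ {v a b c x} (Nv : N3 g v a b c) (Na : N3 g a v b x) (c~x : g ⊢ c ~ x) where

    tight-bcx-⊥ : ∀ S → ¬ T (S v) → ¬ T (S a) → T (S b) → T (S c) → T (S x) → ¬ Tight g S
    tight-bcx-⊥ S v∉S a∉S Sb Sc Sx tight =
      tight-N3-⊥ Nv (S ⊕ a) (⊕-∌ S v∉S (~⇒≢ g (N3.v~a Na))) (⊕-new S) (⊕-old S {a} Sb) (⊕-old S {a} Sc)
        (tight-⊕ g S a∉S tight (deg-≥2 g S (N3.b≢c Na) (N3.v~b Na) (N3.v~c Na) Sb Sx))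

    -- `S₁` would block the new edge `b c`, and `S₂` the new edge `b x` of the reduction with `v`
    -- and `a` exchanged. One of `S₁`, `S₂` and their union is a tight set containing `b`, `c` and
    -- `x`; it absorbs `a` through `b` and `x`, and then holds three neighbours of `v`.
    not-both-tight : ∀ S₁ S₂ → ¬ T (S₁ v) → ¬ T (S₁ a) → T (S₁ b) → T (S₁ c) → Tight g S₁ →
      ¬ T (S₂ v) → ¬ T (S₂ a) → T (S₂ b) → T (S₂ x) → ¬ Tight g S₂
    not-both-tight S₁ S₂ v∉₁ a∉₁ b∈₁ c∈₁ tight₁ v∉₂ a∉₂ b∈₂ x∈₂ tight₂ with T? (S₁ x) | T? (S₂ c)
    ... | yes x∈₁ | _       = tight-bcx-⊥ S₁ v∉₁ a∉₁ b∈₁ c∈₁ x∈₁ tight₁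
    ... | no _    | yes c∈₂ = tight-bcx-⊥ S₂ v∉₂ a∉₂ b∈₂ c∈₂ x∈₂ tight₂
    ... | no x∉₁  | no c∉₂  = tight-bcx-⊥ (S₁ ∪ S₂) (∉∪ v∉₁ v∉₂) (∉∪ a∉₁ a∉₂) (∈∪ (inj₁ b∈₁)) (∈∪ (inj₁ c∈₁)) (∈∪ (inj₂ x∈₂))
          (tight-∪ S₁ S₂ b∈₁ b∈₂ c∈₁ c∉₂ x∈₂ x∉₁ c~x tight₁ tight₂)
      where
      ∈∪ : ∀ {y} → T (S₁ y) ⊎ T (S₂ y) → T ((S₁ ∪ S₂) y)
      ∈∪ = Equivalence.from T-∨
      ∉∪ : ∀ {y} → ¬ T (S₁ y) → ¬ T (S₂ y) → ¬ T ((S₁ ∪ S₂) y)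
      ∉∪ {y} p q t = [ p , q ]′ (Equivalence.to (T-∨ {S₁ y}) t)

  -- As `v` is outside `S`, the vertex `a` has at most two neighbours in `S`; removing it lowers the
  -- edge count by no more than the bound.
  tight-∖ : ∀ {a v b x} → N3 g a v b x → (S : Fin m → Bool) → ¬ T (S v) → T (S a) → Tight g S → Tight g (S ∖ a)
  tight-∖ {a} {v} {b} {x} N S v∉S Sa tight = +-cancelʳ-≤ 2 _ _ (begin
    2 * size (S ∖ a) + 2                          ≡⟨ a₁ (size (S ∖ a)) ⟨
    2 * suc (size (S ∖ a))                        ≡⟨ cong (2 *_) (size-∖ S Sa) ⟨
    2 * size S                                    ≤⟨ tight ⟩
    E g (𝟙 ∘ S) + 3                               ≡⟨ cong (_+ 3) (E-cong g (𝟙-∖ S Sa)) ⟩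
    E g (λ y → 𝟙 ((S ∖ a) y) + δ a y) + 3         ≡⟨ cong (_+ 3) (E-insert g (𝟙 ∘ (S ∖ a)) a) ⟩
    e + deg g (𝟙 ∘ (S ∖ a)) a + 3                 ≤⟨ +-monoˡ-≤ 3 (+-monoʳ-≤ e deg≤2) ⟩
    e + 2 + 3                                     ≡⟨ a₂ e ⟩
    e + 3 + 2                                     ∎)
    where
    open ≤-Reasoning
    e = E g (𝟙 ∘ (S ∖ a))
    a₁ : ∀ x → 2 * suc x ≡ 2 * x + 2
    a₁ = solve-∀
    a₂ : ∀ x → x + 2 + 3 ≡ x + 3 + 2
    a₂ = solve-∀
    𝟙≤1 : ∀ t → 𝟙 t ≤ 1
    𝟙≤1 true  = ≤-refl
    𝟙≤1 false = z≤n
    deg≤2 : deg g (𝟙 ∘ (S ∖ a)) a ≤ 2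
    deg≤2 = begin
      deg g (𝟙 ∘ (S ∖ a)) a                                      ≡⟨ deg-N3 g N (𝟙 ∘ (S ∖ a)) ⟩
      𝟙 ((S ∖ a) v) + 𝟙 ((S ∖ a) b) + 𝟙 ((S ∖ a) x)              ≡⟨ cong (λ k → k + 𝟙 ((S ∖ a) b) + 𝟙 ((S ∖ a) x)) (𝟙-F (v∉S ∘ proj₁ ∘ ∖⁻ S {a})) ⟩
      𝟙 ((S ∖ a) b) + 𝟙 ((S ∖ a) x)                              ≤⟨ +-mono-≤ (𝟙≤1 ((S ∖ a) b)) (𝟙≤1 ((S ∖ a) x)) ⟩
      2                                                          ∎

-- NAC-colorings as pairs of labellings

-- With `(r x , b x)` read as a square of a chessboard, this says that the edge moves along the
-- second coordinate only. An edge satisfying it in one of the two orders is a rook move.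
Agree : (Fin m → R) → (Fin m → B) → Fin m → Fin m → Set
Agree r b x y = r x ≡ r y × b x ≢ b y

-- A NAC-coloring is the same as a pair of vertex labellings such that each edge preserves exactly one of
-- them (the labels being the red and the blue connected components); this form is decidable by
-- enumeration and is easy to extend to new vertices.
record IsRook (g : GraphOn m) (r : Fin m → R) (b : Fin m → B) : Set where
  field
    edge-kind : ∀ {x y} → g ⊢ x ~ y → Agree r b x y ⊎ Agree b r x y
    red-edge  : ∃[ x ] ∃[ y ] (g ⊢ x ~ y × Agree r b x y)
    blue-edge : ∃[ x ] ∃[ y ] (g ⊢ x ~ y × Agree b r x y)

IsRook-swap : {g : GraphOn m} {r : Fin m → R} {b : Fin m → B} → IsRook g r b → IsRook g b r
IsRook-swap ρ = record
  { edge-kind = λ e → [ inj₂ , inj₁ ]′ (IsRook.edge-kind ρ e)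
  ; red-edge  = IsRook.blue-edge ρ
  ; blue-edge = IsRook.red-edge ρ }

data Walk {X : Set} : X → List (X × X) → X → Set where
  []   : ∀ {x} → Walk x [] x
  cons : ∀ {x y z es} → Walk y es z → Walk x ((x , y) ∷ es) z

-- The local function of `cycleEdges` cannot be named here. As it does not use the list it is local to,
-- Agda identifies its instances for different lists, so `closing v y (z ∷ zs)` is `(y , z) ∷ closing v z zs`.
closing : X → X → List X → List (X × X)
closing v y ys = drop 1 (cycleEdges (v ∷ y ∷ ys))

closing-walk : (v y : X) (ys : List X) → Walk y (closing v y ys) v
closing-walk v y []       = cons []
closing-walk v y (z ∷ zs) = cons (closing-walk v z zs)

num : (X × X → Bool) → List (X × X) → ℕ
num p es = length (filter (λ e → p e Bool.≟ true) es)

Changes : (X → R) → (X × X → Bool) → X × X → Set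
Changes f p (x , y) = (T (p (x , y)) × f x ≢ f y) ⊎ (¬ T (p (x , y)) × f x ≡ f y)

module _ {X R : Set} (f : X → R) (p : X × X → Bool) where

  no-change : ∀ {x es y} → Walk x es y → All (Changes f p) es → num p es ≡ 0 → f x ≡ f y
  no-change [] [] _ = refl
  no-change (cons {x} {y} {es = es} w) (c ∷ cs) e with trans (≡.sym (length-filter-∷ p (x , y) es)) e
  ... | e′ with c
  ...   | inj₂ (¬t , fx≡fy) rewrite 𝟙-F ¬t = trans fx≡fy (no-change w cs e′)
  ...   | inj₁ (t , _) rewrite 𝟙-T t with e′
  ...     | ()

  one-change : ∀ {x es y} → Walk x es y → All (Changes f p) es → num p es ≡ 1 → f x ≢ f y
  one-change [] [] ()
  one-change (cons {x} {y} {es = es} w) (c ∷ cs) e with trans (≡.sym (length-filter-∷ p (x , y) es)) e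
  ... | e′ with c
  ...   | inj₂ (¬t , fx≡fy) rewrite 𝟙-F ¬t = λ q → one-change w cs e′ (trans (≡.sym fx≡fy) q)
  ...   | inj₁ (t , fx≢fy) rewrite 𝟙-T t = λ q → fx≢fy (trans q (≡.sym (no-change w cs (suc-injective e′))))

  -- If `f` changed at exactly one step of a closed walk, it would differ from itself at the base
  -- point.
  cycle-changes : (vs : List X) → 3 ≤ length vs → All (Changes f p) (cycleEdges vs) → num p (cycleEdges vs) ≢ 1
  cycle-changes (_ ∷ []) (s≤s ())
  cycle-changes (v ∷ y ∷ ys) _ cs e = one-change (cons (closing-walk v y ys)) cs e refl

-- An edge is colored blue when `r` changes along it. By `edge-kind`, `b` then changes exactly along
-- the red edges, so `cycle-changes` rules out a single blue edge through `r` and a single red edge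
-- through `b`.
rook⇒NAC : (g : GraphOn m) → DecidableEquality R → {r : Fin m → R} {b : Fin m → B} → IsRook g r b → HasNAC (graph g)
rook⇒NAC {m} g _≟R_ {r} {b} ρ = coloring ,
  (let (x , y , e , _ , rx≢ry) = blue-edge in x , y , e , c-blue rx≢ry) ,
  (let (x , y , e , rx≡ry , _) = red-edge in x , y , e , c-red rx≡ry) ,
  (λ vs (len , _ , adjs) → cycle-changes r (λ (x , y) → isBlue (c x y)) vs len (All.map blue-changes adjs)) ,
  (λ vs (len , _ , adjs) → cycle-changes b (λ (x , y) → isRed (c x y)) vs len (All.map red-changes adjs))
  where
  open IsRook ρ
  c : Fin m → Fin m → Color
  c x y = if does (r x ≟R r y) then red else blue
  c-red : ∀ {x y} → r x ≡ r y → c x y ≡ red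
  c-red {x} {y} e rewrite dec-true (r x ≟R r y) e = refl
  c-blue : ∀ {x y} → r x ≢ r y → c x y ≡ blue
  c-blue {x} {y} e rewrite dec-false (r x ≟R r y) e = refl
  coloring : EdgeColoring (graph g)
  coloring = record { col = c ; col-sym = λ x y _ → c-sym x y }
    where
    c-sym : ∀ x y → c x y ≡ c y x
    c-sym x y with r x ≟R r y
    ... | yes e = ≡.sym (c-red (≡.sym e))
    ... | no ne = ≡.sym (c-blue (ne ∘ ≡.sym))
  blue-changes : ∀ {e} → g ⊢ proj₁ e ~ proj₂ e → Changes r (λ (x , y) → isBlue (c x y)) e
  blue-changes {x , y} _ with r x ≟R r y
  ... | yes e = inj₂ (id , e)
  ... | no ne = inj₁ (tt , ne)
  red-changes : ∀ {e} → g ⊢ proj₁ e ~ proj₂ e → Changes b (λ (x , y) → isRed (c x y)) e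
  red-changes {x , y} x~y with edge-kind x~y
  ... | inj₁ (rx≡ry , bx≢by) rewrite c-red rx≡ry = inj₁ (tt , bx≢by)
  ... | inj₂ (bx≡by , rx≢ry) rewrite c-blue rx≢ry = inj₂ (id , bx≡by)

-- Components and simple paths: from a NAC-coloring to its labellings

module _ {m : ℕ} (Rel : Fin m → Fin m → Set) (Rel? : ∀ x y → Dec (Rel x y)) (Rel-sym : ∀ {x y} → Rel x y → Rel y x) where

  Labelling : List (Fin m × Fin m) → Set
  Labelling es = Σ (Fin m → Fin m) λ f →
    (∀ {x y} → (x , y) ∈ es → f x ≡ f y) × (∀ {x y} → f x ≡ f y → Star Rel x y)

  -- Union-find: starting from distinct labels, each edge relabels the class of its second end by
  -- the label of its first.
  labelling : (es : List (Fin m × Fin m)) → All (λ (x , y) → Rel x y) es → Labelling es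
  labelling [] [] = id , (λ ()) , λ { refl → ε }
  labelling ((a , c) ∷ es) (a~c ∷ rs) with labelling es rs
  ... | f , f-const , f-sound = f′ , const , λ {x} {y} → sound x y
    where
    merge : Fin m → Fin m
    merge k with k ≟ f c
    ... | yes _ = f a
    ... | no _  = k
    f′ = merge ∘ f
    merge-c : merge (f c) ≡ f a
    merge-c with f c ≟ f c
    ... | yes _ = refl
    ... | no ¬p = contradiction refl ¬p
    merge-a : merge (f a) ≡ f a
    merge-a with f a ≟ f c
    ... | yes _ = refl
    ... | no _  = refl
    const : ∀ {x y} → (x , y) ∈ (a , c) ∷ es → f′ x ≡ f′ y
    const (here refl) = trans merge-a (≡.sym merge-c)
    const (there i)   = cong merge (f-const i)
    sound : ∀ x y → f′ x ≡ f′ y → Star Rel x y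
    sound x y e with f x ≟ f c | f y ≟ f c
    ... | yes p | yes q = f-sound (trans p (≡.sym q))
    ... | yes p | no _  = f-sound p ◅◅ Rel-sym a~c ◅ f-sound e
    ... | no _  | yes q = f-sound e ◅◅ a~c ◅ f-sound (≡.sym q)
    ... | no _  | no _  = f-sound e

  components : Σ (Fin m → Fin m) λ f → (∀ {x y} → Rel x y → f x ≡ f y) × (∀ {x y} → f x ≡ f y → Star Rel x y)
  components with labelling (filter R? pairs) (all-filter R? pairs)
    where
    pairs = cartesianProduct (allFin m) (allFin m)
    R? = λ ((x , y) : Fin m × Fin m) → Rel? x y
  ... | f , const , sound = f , (λ {x} {y} r → const (∈-filter⁺ _ (∈-cartesianProduct⁺ (∈-allFin x) (∈-allFin y)) r)) , sound

  data Path (y : Fin m) : Fin m → List (Fin m) → Set where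
    nil  : Path y y []
    cons : ∀ {x z zs} → Rel x z → x ∉ z ∷ zs → Path y z zs → Path y x (z ∷ zs)

  path-unique : ∀ {y x zs} → Path y x zs → Unique (x ∷ zs)
  path-unique nil = [] ∷ []
  path-unique (cons r x∉ p) = ¬Any⇒All¬ _ x∉ ∷ path-unique p

  suffix : ∀ {y z zs x} → Path y z zs → x ∈ z ∷ zs → ∃ λ xs → Path y x xs
  suffix p (here refl) = _ , p
  suffix (cons _ _ p) (there i) = suffix p i

  -- Loop erasure: if the new first vertex already occurs on the path, the path is cut down to that
  -- occurrence. The absence of repetitions is what `IsCycle` asks for.
  shorten : ∀ {x y} → Star Rel x y → ∃ λ zs → Path y x zs
  shorten ε = _ , nil
  shorten {x} (r ◅ rs) with shorten rs
  ... | zs , p with mem? _≟_ x (_ ∷ zs)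
  ...   | yes i = suffix p i
  ...   | no x∉ = _ , cons r x∉ p

module _ (g : GraphOn m) (κ : EdgeColoring (graph g)) (p : Color → Bool) where

  Link : Fin m → Fin m → Set
  Link x y = g ⊢ x ~ y × p (col κ x y) ≡ false

  link-sym : ∀ {x y} → Link x y → Link y x
  link-sym {x} {y} (e , q) = ~-sym g e , trans (cong p (≡.sym (col-sym κ x y e))) q

  link? : ∀ x y → Dec (Link x y)
  link? x y = T? (edge g x y) ×-dec (p (col κ x y) Bool.≟ false)

  private
    c : Fin m × Fin m → Bool
    c (x , y) = p (col κ x y)

  -- The edges of the path avoid the color class `p`, so only the last edge, back to `x`, can be
  -- counted.
  num-closing : ∀ x {y z zs} → Path Link link? link-sym y z zs → num c (closing x z zs) ≡ 𝟙 (c (y , x))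
  num-closing x nil = trans (length-filter-∷ c _ []) (+-identityʳ _)
  num-closing x {zs = z ∷ zs} (cons {x = w} (_ , q) _ P) = trans (length-filter-∷ c (w , z) (closing x z zs))
    (cong₂ _+_ (cong 𝟙 q) (num-closing x P))

  adj-closing : ∀ x {y z zs} → Path Link link? link-sym y z zs → g ⊢ y ~ x → All (λ (u , v) → g ⊢ u ~ v) (closing x z zs)
  adj-closing x nil e = e ∷ []
  adj-closing x (cons (e , _) _ P) f = e ∷ adj-closing x P f

  -- A simple path between the ends of an edge in the class `p`, itself avoiding `p`, closes up to a
  -- cycle with exactly one edge in `p`.
  closed-by-one : (∀ vs → IsCycle (graph g) vs → numColored (graph g) κ p vs ≢ 1) →
    ∀ {x y} → g ⊢ x ~ y → p (col κ x y) ≡ true → ¬ Star Link x y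
  closed-by-one none {x} {y} x~y px s with shorten Link link? link-sym s
  ... | [] , nil = ~⇒≢ g x~y refl
  -- A path of one step is the edge `x y` itself, which would be both in and outside the class. All
  -- longer paths give cycles with at least three vertices.
  ... | z ∷ [] , cons (_ , q) _ nil = contradiction (trans (≡.sym px) q) λ ()
  ... | z ∷ w ∷ zs , P@(cons (x~z , q) _ P′) = none (x ∷ z ∷ w ∷ zs)
        (s≤s (s≤s (s≤s z≤n)) , path-unique Link link? link-sym P , x~z ∷ adj-closing x P′ (~-sym g x~y))
        (trans (length-filter-∷ c (x , z) (closing x z (w ∷ zs)))
          (cong₂ _+_ (cong 𝟙 q) (trans (num-closing x P′) (cong 𝟙 (trans (cong p (≡.sym (col-sym κ x y x~y))) px)))))

FinRook : GraphOn m → Set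
FinRook {m} g = Σ (Fin m → Fin m) λ r → Σ (Fin m → Fin m) λ b → IsRook g r b

-- The labels are the components of the red and of the blue subgraph. The ends of a red edge lie in
-- different blue components, for otherwise a blue path would close a cycle with exactly one red
-- edge; likewise with the colors exchanged.
NAC⇒rook : (g : GraphOn m) → HasNAC (graph g) → FinRook g
NAC⇒rook {m} g (κ , (bx , by , b~ , b≡) , (rx , ry , r~ , r≡) , no-blue , no-red) =
  r , b , record
    { edge-kind = λ {x} {y} e → kind e (col κ x y) refl
    ; red-edge  = rx , ry , r~ , as-red r~ r≡
    ; blue-edge = bx , by , b~ , as-blue b~ b≡ }
  where
  red-comp  = components (Link g κ isBlue) (link? g κ isBlue) (link-sym g κ isBlue)
  blue-comp = components (Link g κ isRed) (link? g κ isRed) (link-sym g κ isRed)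
  r = proj₁ red-comp
  b = proj₁ blue-comp
  as-red : ∀ {x y} → g ⊢ x ~ y → col κ x y ≡ red → Agree r b x y
  as-red e q = proj₁ (proj₂ red-comp) (e , cong isBlue q) ,
    closed-by-one g κ isRed no-red e (cong isRed q) ∘ proj₂ (proj₂ blue-comp)
  as-blue : ∀ {x y} → g ⊢ x ~ y → col κ x y ≡ blue → Agree b r x y
  as-blue e q = proj₁ (proj₂ blue-comp) (e , cong isRed q) ,
    closed-by-one g κ isBlue no-blue e (cong isBlue q) ∘ proj₂ (proj₂ red-comp)
  kind : ∀ {x y} → g ⊢ x ~ y → (k : Color) → col κ x y ≡ k → Agree r b x y ⊎ Agree b r x y
  kind e red  q = inj₁ (as-red e q)
  kind e blue q = inj₂ (as-blue e q)

-- Deciding whether a NAC-coloring exists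

Searchable : Set → Set₁
Searchable X = {P : X → Set} → (∀ x → Dec (P x)) → Dec (∃ P)

-- The search visits functions rebuilt from their lists of values, so a witness is found only up to
-- `≗`, and `P` has to respect it.
searchable-→ : Searchable X → {P : (Fin k → X) → Set} → (∀ {f h} → f ≗ h → P f → P h) → (∀ f → Dec (P f)) → Dec (∃ P)
searchable-→ {k = zero} s ext P? = map′ (V.[] ,_) (λ (f , p) → ext {f} {V.[]} (λ ()) p) (P? V.[])
searchable-→ {k = suc k} s {P} ext P? = map′
  (λ (x , f , p) → x V.∷ f , p)
  (λ (f , p) → f zero , f ∘ suc , ext (λ { zero → refl ; (suc _) → refl }) p)
  (s λ x → searchable-→ s (λ f≗h → ext λ { zero → refl ; (suc i) → f≗h i }) (λ f → P? (x V.∷ f)))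

searchable-Bool : Searchable Bool
searchable-Bool P? = map′ [ (true ,_) , (false ,_) ]′ (λ { (true , p) → inj₁ p ; (false , p) → inj₂ p }) (P? true ⊎-dec P? false)

IsRook-cong : {g : GraphOn m} {r r′ : Fin m → R} {b b′ : Fin m → B} → r ≗ r′ → b ≗ b′ → IsRook g r b → IsRook g r′ b′
IsRook-cong {m} {r = r} {r′} {b} {b′} r≗ b≗ ρ = record
  { edge-kind = λ e → [ inj₁ ∘ agree r≗ b≗ , inj₂ ∘ agree b≗ r≗ ]′ (edge-kind e)
  ; red-edge  = let (x , y , e , a) = red-edge in x , y , e , agree r≗ b≗ a
  ; blue-edge = let (x , y , e , a) = blue-edge in x , y , e , agree b≗ r≗ a }
  where
  open IsRook ρ
  agree : {P Q : Set} {f f′ : Fin m → P} {h h′ : Fin m → Q} → f ≗ f′ → h ≗ h′ → ∀ {x y} → Agree f h x y → Agree f′ h′ x y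
  agree f≗ h≗ {x} {y} (p , q) = trans (≡.sym (f≗ x)) (trans p (f≗ y)) , λ e → q (trans (h≗ x) (trans e (≡.sym (h≗ y))))

isRook? : (g : GraphOn m) → DecidableEquality R → DecidableEquality B → (r : Fin m → R) (b : Fin m → B) → Dec (IsRook g r b)
isRook? g _≟R_ _≟B_ r b = map′
  (λ (k , p , q) → record { edge-kind = λ {x} {y} → k x y ; red-edge = p ; blue-edge = q })
  (λ ρ → (λ x y → IsRook.edge-kind ρ) , IsRook.red-edge ρ , IsRook.blue-edge ρ)
  ((all? λ x → all? λ y → T? (edge g x y) →-dec (red? x y ⊎-dec blue? x y))
    ×-dec (any? λ x → any? λ y → T? (edge g x y) ×-dec red? x y)
    ×-dec (any? λ x → any? λ y → T? (edge g x y) ×-dec blue? x y))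
  where
  red?  = λ x y → (r x ≟R r y) ×-dec ¬? (b x ≟B b y)
  blue? = λ x y → (b x ≟B b y) ×-dec ¬? (r x ≟R r y)

-- By `NAC⇒rook` the vertices themselves suffice as labels, which leaves finitely many pairs of
-- labellings to test.
hasNAC? : (g : GraphOn m) → Dec (HasNAC (graph g))
hasNAC? {m} g = map′ (λ (r , b , ρ) → rook⇒NAC g _≟_ ρ) (NAC⇒rook g)
  (searchable-→ any? (λ r≗ (b , ρ) → b , IsRook-cong r≗ (λ _ → refl) ρ) λ r →
   searchable-→ any? (λ b≗ ρ → IsRook-cong (λ _ → refl) b≗ ρ) λ b → isRook? g _≟_ _≟_ r b)

-- Constructing NAC-colorings

Agree-sym : {r : Fin m → R} {b : Fin m → B} → ∀ {x y} → Agree r b x y → Agree r b y x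
Agree-sym (p , q) = ≡.sym p , q ∘ ≡.sym

-- The blue edges are those inside M joining different r-classes; all of M is one blue component.
merge-rook : (g : GraphOn m) (r : Fin m → R) (M : Fin m → Bool) {o : Fin m} → T (M o) →
  (∀ {x y} → g ⊢ x ~ y → (T (M x) × T (M y) × r x ≢ r y) ⊎ (r x ≡ r y × ¬ (T (M x) × T (M y)))) →
  (∃[ x ] ∃[ y ] (g ⊢ x ~ y × r x ≡ r y)) → (∃[ x ] ∃[ y ] (g ⊢ x ~ y × r x ≢ r y)) →
  IsRook g r (λ x → if M x then o else x)
merge-rook {m = m} g r M {o} Mo kind (x , y , e , p) (x′ , y′ , e′ , p′) = record
  { edge-kind = kind′
  ; red-edge  = x , y , e , [ id , (λ (_ , q) → contradiction p q) ]′ (kind′ e)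
  ; blue-edge = x′ , y′ , e′ , [ (λ (q , _) → contradiction q p′) , id ]′ (kind′ e′) }
  where
  b : Fin m → Fin m
  b z = if M z then o else z
  b-in : ∀ {z} → T (M z) → b z ≡ o
  b-in {z} t with M z
  ... | true = refl
  b-≢ : ∀ {z w} → z ≢ w → ¬ (T (M z) × T (M w)) → b z ≢ b w
  b-≢ {z} {w} z≢w h with M z in ez | M w in ew
  ... | true  | true  = ⊥-elim (h (tt , tt))
  ... | true  | false = λ { refl → subst T ew Mo }
  ... | false | true  = λ { refl → subst T ez Mo }
  ... | false | false = z≢w
  kind′ : ∀ {z w} → g ⊢ z ~ w → Agree r b z w ⊎ Agree b r z w
  kind′ z~w with kind z~w
  ... | inj₁ (Mz , Mw , rz≢rw) = inj₂ (trans (b-in Mz) (≡.sym (b-in Mw)) , rz≢rw)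
  ... | inj₂ (rz≡rw , h)       = inj₁ (rz≡rw , b-≢ (~⇒≢ g z~w) h)

-- The edges at `v` are blue and all others red. The neighbours of `v` are independent, so the star
-- spans no red edge; `u w` shows that red occurs.
star-NAC : (g : GraphOn m) {v u w : Fin m} → (∀ {x y} → g ⊢ v ~ x → g ⊢ v ~ y → ¬ g ⊢ x ~ y) →
  g ⊢ v ~ u → g ⊢ u ~ w → v ≢ w → HasNAC (graph g)
star-NAC {m} g {v} {u} {w} no-triangle v~u u~w v≢w = rook⇒NAC g Bool._≟_
  (merge-rook g (eq v) M {v} (Equivalence.from (T-∨ {eq v v}) (inj₁ (≡⇒T-eq {x = v} refl))) kind
    (u , w , u~w , trans (dec-false (v ≟ u) (~⇒≢ g v~u)) (≡.sym (dec-false (v ≟ w) v≢w)))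
    (v , u , v~u , λ e → contradiction (trans (≡.sym (eq-refl v)) (trans e (dec-false (v ≟ u) (~⇒≢ g v~u)))) λ ()))
  where
  M : Fin m → Bool
  M x = eq v x ∨ edge g v x
  kind : ∀ {x y} → g ⊢ x ~ y → (T (M x) × T (M y) × eq v x ≢ eq v y) ⊎ (eq v x ≡ eq v y × ¬ (T (M x) × T (M y)))
  kind {x} {y} x~y with v ≟ x | v ≟ y
  ... | yes refl | yes refl = ⊥-elim (~⇒≢ g x~y refl)
  ... | yes refl | no _     = inj₁ (tt , x~y , λ ())
  ... | no _     | yes refl = inj₁ (~-sym g x~y , tt , λ ())
  ... | no _     | no _     = inj₂ (refl , λ (v~x , v~y) → no-triangle v~x v~y x~y)

module _ (g : GraphOn m) {v a b c x : Fin m} (Nv : N3 g v a b c) (Na : N3 g a v b x) where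

  private
    module Nv = N3 Nv
    module Na = N3 Na

  -- The blue edges are those meeting `v` or `a`. They span `v`, `a`, `b`, `c`, `x`, and no red edge
  -- lies among these because `b`, `c`, `x` are independent. The red classes are `v` alone, `a`
  -- alone and everything else; a further neighbour `w` of `c` supplies a red edge.
  double-star-NAC : ¬ g ⊢ b ~ c → ¬ g ⊢ b ~ x → ¬ g ⊢ c ~ x → (∀ z → 2 ≤ d g z) → ¬ g ⊢ a ~ c → HasNAC (graph g)
  double-star-NAC b≁c b≁x c≁x d≥2 a≁c = rook⇒NAC g ℕ._≟_
    (merge-rook g r M {v} Mv kind
      (c , w , c~w , trans (r-0 (~⇒≢ g Nv.v~c) Nv.a≢c) (≡.sym (r-0 v≢w λ { refl → a≁c (~-sym g c~w) })))
      (v , c , Nv.v~c , λ e → contradiction (trans (≡.sym r-v) (trans e (r-0 (~⇒≢ g Nv.v~c) Nv.a≢c))) λ ()))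
    where
    further = other (edge g c) v (d≥2 c)
    w = proj₁ further
    c~w = proj₁ (proj₂ further)
    v≢w = proj₂ (proj₂ further)
    r : Fin m → ℕ
    r z = if eq v z then 1 else (if eq a z then 2 else 0)
    M : Fin m → Bool
    M z = eq v z ∨ (edge g v z ∨ edge g a z)
    Mv : T (M v)
    Mv = Equivalence.from (T-∨ {eq v v}) (inj₁ (≡⇒T-eq {x = v} refl))
    r-v : r v ≡ 1
    r-v rewrite eq-refl v = refl
    r-0 : ∀ {z} → v ≢ z → a ≢ z → r z ≡ 0
    r-0 {z} p q rewrite dec-false (v ≟ z) p | dec-false (a ≟ z) q = refl
    M-v~ : ∀ {z} → g ⊢ v ~ z → T (M z)
    M-v~ {z} t = Equivalence.from (T-∨ {eq v z}) (inj₂ (Equivalence.from (T-∨ {edge g v z}) (inj₁ t)))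
    M-a~ : ∀ {z} → g ⊢ a ~ z → T (M z)
    M-a~ {z} t = Equivalence.from (T-∨ {eq v z}) (inj₂ (Equivalence.from (T-∨ {edge g v z}) (inj₂ t)))
    M⁻ : ∀ {z} → v ≢ z → a ≢ z → T (M z) → z ≡ b ⊎ z ≡ c ⊎ z ≡ x
    M⁻ {z} v≢z a≢z t with Equivalence.to (T-∨ {eq v z}) t
    ... | inj₁ q = ⊥-elim (v≢z (T-eq⇒≡ q))
    ... | inj₂ q with Equivalence.to (T-∨ {edge g v z}) q
    ...   | inj₁ v~z = [ (λ p → ⊥-elim (a≢z (≡.sym p))) , [ inj₁ , inj₂ ∘ inj₁ ]′ ]′ (Nv.only v~z)
    ...   | inj₂ a~z = [ (λ p → ⊥-elim (v≢z (≡.sym p))) , [ inj₁ , inj₂ ∘ inj₂ ]′ ]′ (Na.only a~z)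
    independent : ∀ {y z} → y ≡ b ⊎ y ≡ c ⊎ y ≡ x → z ≡ b ⊎ z ≡ c ⊎ z ≡ x → ¬ g ⊢ y ~ z
    independent (inj₁ refl)        (inj₁ refl)        e = ~⇒≢ g e refl
    independent (inj₁ refl)        (inj₂ (inj₁ refl)) e = b≁c e
    independent (inj₁ refl)        (inj₂ (inj₂ refl)) e = b≁x e
    independent (inj₂ (inj₁ refl)) (inj₁ refl)        e = b≁c (~-sym g e)
    independent (inj₂ (inj₁ refl)) (inj₂ (inj₁ refl)) e = ~⇒≢ g e refl
    independent (inj₂ (inj₁ refl)) (inj₂ (inj₂ refl)) e = c≁x e
    independent (inj₂ (inj₂ refl)) (inj₁ refl)        e = b≁x (~-sym g e)
    independent (inj₂ (inj₂ refl)) (inj₂ (inj₁ refl)) e = c≁x (~-sym g e)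
    independent (inj₂ (inj₂ refl)) (inj₂ (inj₂ refl)) e = ~⇒≢ g e refl
    r-≢ : ∀ {y z} → y ≢ z → y ≡ v ⊎ y ≡ a → r y ≢ r z
    r-≢ {y} {z} y≢z h with v ≟ y | v ≟ z | a ≟ y | a ≟ z | h
    ... | yes p | yes q | _     | _     | _ = ⊥-elim (y≢z (trans (≡.sym p) q))
    ... | yes _ | no _  | _     | yes _ | _ = λ ()
    ... | yes _ | no _  | _     | no _  | _ = λ ()
    ... | no _  | _     | yes p | yes q | _ = ⊥-elim (y≢z (trans (≡.sym p) q))
    ... | no _  | yes _ | yes _ | no _  | _ = λ ()
    ... | no _  | no _  | yes _ | no _  | _ = λ ()
    ... | no p  | _     | no q  | _     | inj₁ e = ⊥-elim (p (≡.sym e))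
    ... | no p  | _     | no q  | _     | inj₂ e = ⊥-elim (q (≡.sym e))
    core : ∀ {y z} → y ≡ v ⊎ y ≡ a → g ⊢ y ~ z → T (M y) × T (M z) × r y ≢ r z
    core (inj₁ refl) e = Mv , M-v~ e , r-≢ (~⇒≢ g e) (inj₁ refl)
    core (inj₂ refl) e = M-v~ Nv.v~a , M-a~ e , r-≢ (~⇒≢ g e) (inj₂ refl)
    core? : ∀ y → (y ≡ v ⊎ y ≡ a) ⊎ (v ≢ y × a ≢ y)
    core? y with v ≟ y | a ≟ y
    ... | yes refl | _        = inj₁ (inj₁ refl)
    ... | no _     | yes refl = inj₁ (inj₂ refl)
    ... | no p     | no q     = inj₂ (p , q)
    kind : ∀ {y z} → g ⊢ y ~ z → (T (M y) × T (M z) × r y ≢ r z) ⊎ (r y ≡ r z × ¬ (T (M y) × T (M z)))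
    kind {y} {z} e with core? y | core? z
    ... | inj₁ p | _ = inj₁ (core p e)
    ... | inj₂ _ | inj₁ q = let (Mz , My , ne) = core q (~-sym g e) in inj₁ (My , Mz , ne ∘ ≡.sym)
    ... | inj₂ (p , q) | inj₂ (p′ , q′) = inj₂ (trans (r-0 p q) (≡.sym (r-0 p′ q′)) ,
            λ (My , Mz) → independent (M⁻ p q My) (M⁻ p′ q′ Mz) e)

  -- The triangle `v a b` hangs on the rest of the graph by the edges `v c`, `a x`, `b y`, which are
  -- made blue. They form a matching because `c`, `x`, `y` are distinct. `r` separates the two sides
  -- of this cut, and `f` contracts the matching; distinctness of `c`, `x`, `y` keeps the edges of
  -- the triangle uncontracted.
  matching-NAC : ∀ {y} → N3 g b v a y → ¬ g ⊢ a ~ c → ¬ g ⊢ b ~ c → ¬ g ⊢ b ~ x → HasNAC (graph g)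
  matching-NAC {y} Nb a≁c b≁c b≁x = rook⇒NAC g Bool._≟_ {r} {f} record
    { edge-kind = kind
    ; red-edge  = v , a , Nv.v~a , trans r-v (≡.sym r-a) , λ e → x≢c (trans (≡.sym f-a) (trans (≡.sym e) f-v))
    ; blue-edge = v , c , Nv.v~c , trans f-v (≡.sym (f-out c∉)) , λ e → contradiction (trans (≡.sym r-v) (trans e (r-out c∉))) λ () }
    where
    module Nb = N3 Nb
    r : Fin m → Bool
    r z = eq v z ∨ (eq a z ∨ eq b z)
    f : Fin m → Fin m
    f z = if eq v z then c else (if eq a z then x else (if eq b z then y else z))
    Out : Fin m → Set
    Out z = v ≢ z × a ≢ z × b ≢ z
    x≢c : x ≢ c
    x≢c refl = a≁c Na.v~c
    y≢c : y ≢ c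
    y≢c refl = b≁c Nb.v~c
    y≢x : y ≢ x
    y≢x refl = b≁x Nb.v~c
    c∉ : Out c
    c∉ = ~⇒≢ g Nv.v~c , Nv.a≢c , Nv.b≢c
    x∉ : Out x
    x∉ = Na.a≢c , ~⇒≢ g Na.v~c , Na.b≢c
    y∉ : Out y
    y∉ = Nb.a≢c , Nb.b≢c , ~⇒≢ g Nb.v~c
    r-v : r v ≡ true
    r-v rewrite eq-refl v = refl
    r-a : r a ≡ true
    r-a rewrite dec-false (v ≟ a) (~⇒≢ g Nv.v~a) | eq-refl a = refl
    r-b : r b ≡ true
    r-b rewrite dec-false (v ≟ b) (~⇒≢ g Nv.v~b) | dec-false (a ≟ b) Nv.a≢b | eq-refl b = refl
    r-out : ∀ {z} → Out z → r z ≡ false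
    r-out {z} (p , q , s) rewrite dec-false (v ≟ z) p | dec-false (a ≟ z) q | dec-false (b ≟ z) s = refl
    f-v : f v ≡ c
    f-v rewrite eq-refl v = refl
    f-a : f a ≡ x
    f-a rewrite dec-false (v ≟ a) (~⇒≢ g Nv.v~a) | eq-refl a = refl
    f-b : f b ≡ y
    f-b rewrite dec-false (v ≟ b) (~⇒≢ g Nv.v~b) | dec-false (a ≟ b) Nv.a≢b | eq-refl b = refl
    f-out : ∀ {z} → Out z → f z ≡ z
    f-out {z} (p , q , s) rewrite dec-false (v ≟ z) p | dec-false (a ≟ z) q | dec-false (b ≟ z) s = refl
    inner : ∀ {p q p′ q′} → r p ≡ true → r q ≡ true → f p ≡ p′ → f q ≡ q′ → p′ ≢ q′ → Agree r f p q ⊎ Agree f r p q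
    inner rp rq fp fq ne = inj₁ (trans rp (≡.sym rq) , λ e → ne (trans (≡.sym fp) (trans e fq)))
    cut : ∀ {p q} → r p ≡ true → Out q → f p ≡ q → Agree r f p q ⊎ Agree f r p q
    cut rp q∉ fp = inj₂ (trans fp (≡.sym (f-out q∉)) , λ e → contradiction (trans (≡.sym rp) (trans e (r-out q∉))) λ ())
    In : Fin m → Set
    In z = z ≡ v ⊎ z ≡ a ⊎ z ≡ b
    core : ∀ {p q} → In p → g ⊢ p ~ q → Agree r f p q ⊎ Agree f r p q
    core (inj₁ refl) e with Nv.only e
    ... | inj₁ refl        = inner r-v r-a f-v f-a (x≢c ∘ ≡.sym)
    ... | inj₂ (inj₁ refl) = inner r-v r-b f-v f-b (y≢c ∘ ≡.sym)
    ... | inj₂ (inj₂ refl) = cut r-v c∉ f-v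
    core (inj₂ (inj₁ refl)) e with Na.only e
    ... | inj₁ refl        = inner r-a r-v f-a f-v x≢c
    ... | inj₂ (inj₁ refl) = inner r-a r-b f-a f-b (y≢x ∘ ≡.sym)
    ... | inj₂ (inj₂ refl) = cut r-a x∉ f-a
    core (inj₂ (inj₂ refl)) e with Nb.only e
    ... | inj₁ refl        = inner r-b r-v f-b f-v y≢c
    ... | inj₂ (inj₁ refl) = inner r-b r-a f-b f-a y≢x
    ... | inj₂ (inj₂ refl) = cut r-b y∉ f-b
    in? : ∀ z → In z ⊎ Out z
    in? z with v ≟ z | a ≟ z | b ≟ z
    ... | yes refl | _        | _        = inj₁ (inj₁ refl)
    ... | no _     | yes refl | _        = inj₁ (inj₂ (inj₁ refl))
    ... | no _     | no _     | yes refl = inj₁ (inj₂ (inj₂ refl))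
    ... | no p     | no q     | no s     = inj₂ (p , q , s)
    kind : ∀ {p q} → g ⊢ p ~ q → Agree r f p q ⊎ Agree f r p q
    kind {p} {q} e with in? p | in? q
    ... | inj₁ i | _      = core i e
    ... | inj₂ _ | inj₁ i = [ inj₁ ∘ Agree-sym {r = r} {f} , inj₂ ∘ Agree-sym {r = f} {r} ]′ (core i (~-sym g e))
    ... | inj₂ o | inj₂ o′ = inj₁ (trans (r-out o) (≡.sym (r-out o′)) , λ h → ~⇒≢ g e (trans (≡.sym (f-out o)) (trans h (f-out o′))))

-- Extending a pair of labellings to a new vertex

data Split (v : Fin (suc m)) : Fin (suc m) → Set where
  at  : Split v v
  off : ∀ x → Split v (punchIn v x)

split : (v x : Fin (suc m)) → Split v x
split v x with v ≟ x
... | yes refl = at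
... | no v≢x with unpunch v v≢x
...   | y , refl = off y

module _ (g : GraphOn (suc m)) (v : Fin (suc m)) (g′ : GraphOn m) {r : Fin m → R} {b : Fin m → B} (ρ : IsRook g′ r b) where

  private
    open IsRook ρ
    _⟪_⟫ : {P : Set} → (Fin m → P) → P → Fin (suc m) → P
    f ⟪ p ⟫ = insertAt f v p
    new : {P : Set} (f : Fin m → P) (p : P) → (f ⟪ p ⟫) v ≡ p
    new f p = insertAt-lookup f v p
    old : {P : Set} (f : Fin m → P) (p : P) → ∀ x → (f ⟪ p ⟫) (punchIn v x) ≡ f x
    old f p = insertAt-punchIn f v p
    lift : {P Q : Set} (f : Fin m → P) (h : Fin m → Q) (p : P) (q : Q) → ∀ {x y} →
      Agree f h x y → Agree (f ⟪ p ⟫) (h ⟪ q ⟫) (punchIn v x) (punchIn v y)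
    lift f h p q {x} {y} (s , t) = trans (old f p x) (trans s (≡.sym (old f p y))) ,
      λ e → t (trans (≡.sym (old h q x)) (trans e (old h q y)))

  -- If all neighbours of v lie in one red component, v joins it as its only meeting point with a new blue component.
  -- The edges of g′ missing from g have to be red, so that no color disappears.
  extend-rook : (o : R) →
    (∀ {x y} → g ⊢ punchIn v x ~ punchIn v y → g′ ⊢ x ~ y) →
    (∀ {x y} → g′ ⊢ x ~ y → g ⊢ punchIn v x ~ punchIn v y ⊎ r x ≡ r y) →
    (∀ {x} → g ⊢ v ~ punchIn v x → r x ≡ o) →
    (∃ λ x → g ⊢ v ~ punchIn v x) →
    IsRook g (insertAt r v o) (insertAt (just ∘ b) v nothing)
  extend-rook o down up nbr (w , v~w) = record
    { edge-kind = λ {x} {y} e → kind (split v x) (split v y) e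
    ; red-edge  = v , punchIn v w , v~w , at-v v~w
    ; blue-edge = keep-blue blue-edge }
    where
    r′ = r ⟪ o ⟫
    b′ = (just ∘ b) ⟪ nothing ⟫
    lift-just : ∀ {x y} → Agree r b x y → Agree r (just ∘ b) x y
    lift-just (p , q) = p , q ∘ just-injective
    lift-just′ : ∀ {x y} → Agree b r x y → Agree (just ∘ b) r x y
    lift-just′ (p , q) = cong just p , q
    at-v : ∀ {x} → g ⊢ v ~ punchIn v x → Agree r′ b′ v (punchIn v x)
    at-v {x} e = trans (new r o) (≡.sym (trans (old r o x) (nbr e))) ,
      λ q → contradiction (trans (≡.sym (new (just ∘ b) nothing)) (trans q (old (just ∘ b) nothing x))) λ ()
    kind : ∀ {x y} → Split v x → Split v y → g ⊢ x ~ y → Agree r′ b′ x y ⊎ Agree b′ r′ x y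
    kind at      at      e = ⊥-elim (~⇒≢ g e refl)
    kind at      (off y) e = inj₁ (at-v e)
    kind (off x) at      e = inj₁ (Agree-sym {r = r′} {b′} (at-v (~-sym g e)))
    kind (off x) (off y) e = [ inj₁ ∘ lift r (just ∘ b) o nothing ∘ lift-just
                             , inj₂ ∘ lift (just ∘ b) r nothing o ∘ lift-just′ ]′ (edge-kind (down e))
    keep-blue : (∃[ x ] ∃[ y ] (g′ ⊢ x ~ y × Agree b r x y)) → ∃[ x ] ∃[ y ] (g ⊢ x ~ y × Agree b′ r′ x y)
    keep-blue (x , y , e , a) with up e
    ... | inj₁ e′ = punchIn v x , punchIn v y , e′ , lift (just ∘ b) r nothing o (lift-just′ a)
    ... | inj₂ q  = contradiction q (proj₂ a)

  -- The new vertex copies both labels of `c`. Each of its neighbours is also a neighbour of `c`, so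
  -- its edges inherit the colors of the corresponding edges at `c`.
  twin-rook : (c : Fin m) →
    (∀ {x y} → g ⊢ punchIn v x ~ punchIn v y → g′ ⊢ x ~ y) →
    (∀ {x y} → g′ ⊢ x ~ y → g ⊢ punchIn v x ~ punchIn v y) →
    (∀ {x} → g ⊢ v ~ punchIn v x → g′ ⊢ c ~ x) →
    IsRook g (insertAt r v (r c)) (insertAt b v (b c))
  twin-rook c down up twin = record
    { edge-kind = λ {x} {y} e → kind (split v x) (split v y) e
    ; red-edge  = let (x , y , e , a) = red-edge in punchIn v x , punchIn v y , up e , lift r b (r c) (b c) a
    ; blue-edge = let (x , y , e , a) = blue-edge in punchIn v x , punchIn v y , up e , lift b r (b c) (r c) a }
    where
    r′ = r ⟪ r c ⟫
    b′ = b ⟪ b c ⟫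
    like-c : {P Q : Set} (f : Fin m → P) (h : Fin m → Q) → ∀ {x} → Agree f h c x → Agree (f ⟪ f c ⟫) (h ⟪ h c ⟫) v (punchIn v x)
    like-c f h {x} (p , q) = trans (new f (f c)) (trans p (≡.sym (old f (f c) x))) ,
      λ e → q (trans (≡.sym (new h (h c))) (trans e (old h (h c) x)))
    at-v : ∀ {x} → g ⊢ v ~ punchIn v x → Agree r′ b′ v (punchIn v x) ⊎ Agree b′ r′ v (punchIn v x)
    at-v e = [ inj₁ ∘ like-c r b , inj₂ ∘ like-c b r ]′ (edge-kind (twin e))
    kind : ∀ {x y} → Split v x → Split v y → g ⊢ x ~ y → Agree r′ b′ x y ⊎ Agree b′ r′ x y
    kind at      at      e = ⊥-elim (~⇒≢ g e refl)
    kind at      (off y) e = at-v e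
    kind (off x) at      e = [ inj₁ ∘ Agree-sym {r = r′} {b′} , inj₂ ∘ Agree-sym {r = b′} {r′} ]′ (at-v (~-sym g e))
    kind (off x) (off y) e = [ inj₁ ∘ lift r b (r c) (b c) , inj₂ ∘ lift b r (b c) (r c) ]′ (edge-kind (down e))

-- The induction

module _ (g : GraphOn (suc m)) {v : Fin (suc m)} where

  module _ {u u′ : Fin m} (N : N2 g v (punchIn v u) (punchIn v u′)) where

    N2-hennebergI : HennebergI (graph (del g v)) (graph g)
    N2-hennebergI = refl , v , u , u′ , N2.a≢b N ∘ cong (punchIn v) , (λ _ _ → mk⇔ id id) , λ x → mk⇔
      (λ e → [ inj₁ ∘ punchIn-injective v _ _ , inj₂ ∘ punchIn-injective v _ _ ]′ (N2.only N e))
      [ (λ { refl → N2.v~a N }) , (λ { refl → N2.v~b N }) ]′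

    private
      G  = graph g
      G′ = graph (del g v)

    lift-edge : Edge G′ → Edge G
    lift-edge ((x , y) , x<y , x~y) = (punchIn v x , punchIn v y) ,
      ≤∧≢⇒< (punchIn-mono-≤ v x y (<⇒≤ x<y)) (~⇒≢ g x~y ∘ toℕ-injective) , x~y

    TriRel-sym : ∀ {e₁ e₂} → TriRel G e₁ e₂ → TriRel G e₂ e₁
    TriRel-sym (a , b , c , t , i , j) = a , b , c , t , j , i

    lift-TriRel : ∀ {e₁ e₂} → TriRel G′ e₁ e₂ → TriRel G (lift-edge e₁) (lift-edge e₂)
    lift-TriRel (a , b , c , t , (i , j) , (k , l)) = punchIn v a , punchIn v b , punchIn v c , t , (up i , up j) , (up k , up l)
      where
      up : ∀ {x} → x ∈₃ (a , b , c) → punchIn v x ∈₃ (punchIn v a , punchIn v b , punchIn v c)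
      up = [ inj₁ ∘ cong (punchIn v) , [ inj₂ ∘ inj₁ ∘ cong (punchIn v) , inj₂ ∘ inj₂ ∘ cong (punchIn v) ]′ ]′

    -- Both edges at `v` lie in one triangle with `u u′`, an edge that survives the deletion. Used
    -- contrapositively, this passes the failure of triangle-connectedness to the smaller graph.
    triConnected-undelete : del g v ⊢ u ~ u′ → TriConnected G′ → TriConnected G
    triConnected-undelete u~u′ tc e₁ e₂ =
      let (f₁ , s₁) = descend e₁ ; (f₂ , s₂) = descend e₂
      in s₁ ◅◅ gmap lift-edge (λ {e} {f} → lift-TriRel {e} {f}) (tc f₁ f₂) ◅◅ reverse (λ {e} {f} → TriRel-sym {e} {f}) s₂
      where
      T₃ = (v , punchIn v u , punchIn v u′)
      tri : IsTriangle G v (punchIn v u) (punchIn v u′)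
      tri = N2.v~a N , u~u′ , N2.v~b N
      base : Σ (Edge G′) λ f → EdgeIn G (lift-edge f) T₃
      base with toEdge (del g v) u~u′
      ... | f , inj₁ refl = f , inj₂ (inj₁ refl) , inj₂ (inj₂ refl)
      ... | f , inj₂ refl = f , inj₂ (inj₂ refl) , inj₂ (inj₁ refl)
      via-base : ∀ {e} → EdgeIn G e T₃ → Σ (Edge G′) λ f → Star (TriRel G) e (lift-edge f)
      via-base i = proj₁ base , (v , punchIn v u , punchIn v u′ , tri , i , proj₂ base) ◅ ε
      descend : (e : Edge G) → Σ (Edge G′) λ f → Star (TriRel G) e (lift-edge f)
      descend ((x , y) , x<y , x~y) with split v x | split v y
      ... | at    | at    = contradiction refl (~⇒≢ g x~y)
      ... | at    | off y = via-base (inj₁ refl , inj₂ (N2.only N x~y))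
      ... | off x | at    = via-base (inj₂ (N2.only N (~-sym g x~y)) , inj₁ refl)
      ... | off x | off y = f , subst (λ lt → Star (TriRel G) ((punchIn v x , punchIn v y) , lt , x~y) (lift-edge f)) (<-irrelevant _ _) ε
        where
        f : Edge G′
        f = (x , y) , ≤∧≢⇒< (punchIn-cancel-≤ v x y (<⇒≤ x<y)) (~⇒≢ (del g v) x~y ∘ toℕ-injective) , x~y

    N2-extend-rook : {r : Fin m → R} {b : Fin m → B} → IsRook (del g v) r b → r u ≡ r u′ →
      IsRook g (insertAt r v (r u)) (insertAt (just ∘ b) v nothing)
    N2-extend-rook {r = r} ρ ru≡ru′ = extend-rook g v (del g v) ρ (r u) id inj₁
      (λ e → [ cong r ∘ punchIn-injective v _ _ , (λ p → trans (cong r (punchIn-injective v _ _ p)) (≡.sym ru≡ru′)) ]′ (N2.only N e))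
      (u , N2.v~a N)

  module _ {a b c : Fin m} (N : N3 g v (punchIn v a) (punchIn v b) (punchIn v c)) (a≢c : a ≢ c) (a≁c : ¬ del g v ⊢ a ~ c) where

    private
      g′ = del-add g v a≢c a≁c
      p = punchIn-injective v

    N3-hennebergII : HennebergII (graph g′) (graph g)
    N3-hennebergII = refl , v , b , a , c ,
      N3.a≢b N ∘ ≡.sym ∘ cong (punchIn v) , N3.b≢c N ∘ cong (punchIn v) , a≢c , ~-add-new (del g v) a≢c ,
      (λ x y → mk⇔
        (λ e → ~-add⁺ (del g v) a≢c e , λ { (inj₁ (refl , refl)) → a≁c e ; (inj₂ (refl , refl)) → a≁c (~-sym g e) })
        (λ (e , ¬l) → [ id , ⊥-elim ∘ ¬l ]′ (~-add⁻ (del g v) a≢c e))) ,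
      λ x → mk⇔
        (λ e → [ inj₂ ∘ inj₁ ∘ p _ _ , [ inj₁ ∘ p _ _ , inj₂ ∘ inj₂ ∘ p _ _ ]′ ]′ (N3.only N e))
        [ (λ { refl → N3.v~b N }) , [ (λ { refl → N3.v~a N }) , (λ { refl → N3.v~c N }) ]′ ]′

    N3-extend-NAC : DecidableEquality R → {r : Fin m → R} {β : Fin m → B} → IsRook g′ r β → r a ≡ r b → r b ≡ r c → HasNAC (graph g)
    N3-extend-NAC _≟R_ {r} ρ ra≡rb rb≡rc = rook⇒NAC g _≟R_ (extend-rook g v g′ ρ (r b)
      (~-add⁺ (del g v) a≢c)
      (λ e → [ inj₁ , inj₂ ∘ same ]′ (~-add⁻ (del g v) a≢c e))
      (λ e → [ (λ q → trans (cong r (p _ _ q)) ra≡rb) , [ cong r ∘ p _ _ , (λ q → trans (cong r (p _ _ q)) (≡.sym rb≡rc)) ]′ ]′ (N3.only N e))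
      (b , N3.v~b N))
      where
      same : ∀ {x y} → (x ≡ a × y ≡ c) ⊎ (x ≡ c × y ≡ a) → r x ≡ r y
      same (inj₁ (refl , refl)) = trans ra≡rb rb≡rc
      same (inj₂ (refl , refl)) = ≡.sym (trans ra≡rb rb≡rc)

    -- `a` and `c` exchange the neighbour `v` for each other, so `b` is the only vertex to lose a
    -- degree.
    d-N3-reduce : ∀ z → d g′ z + δ b z ≡ d g (punchIn v z)
    d-N3-reduce z = begin
      d g′ z + δ b z                                   ≡⟨ cong (_+ δ b z) (d-del-add g v a≢c a≁c z) ⟩
      d (del g v) z + (δ a z + δ c z) + δ b z          ≡⟨ rearr (d (del g v) z) (δ a z) (δ b z) (δ c z) ⟩
      (δ a z + δ b z + δ c z) + d (del g v) z          ≡⟨ cong (_+ d (del g v) z) A≡ ⟨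
      A g v (punchIn v z) + d (del g v) z              ≡⟨ d-del g v z ⟨
      d g (punchIn v z)                                ∎
      where
      open ≡-Reasoning
      rearr : ∀ e p q s → e + (p + s) + q ≡ (p + q + s) + e
      rearr = solve-∀
      A≡ : A g v (punchIn v z) ≡ δ a z + δ b z + δ c z
      A≡ = trans (N3-A g N (punchIn v z)) (cong₂ _+_ (cong₂ _+_ (δ-punchIn v a z) (δ-punchIn v b z)) (δ-punchIn v c z))

-- The vertices other than `v` span at most 2m - 3 of the 2(m + 1) - 3 edges, so at least two edges
-- end at `v`.
min-degree : (g : GraphOn (suc m)) → Laman g → 2 ≤ m → ∀ v → 2 ≤ d g v
min-degree {m} g L 2≤m v = +-cancelˡ-≤ (2 * m) 2 _ (begin
  2 * m + 2                         ≡⟨ a₁ m ⟨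
  2 * suc m                         ≡⟨ total L ⟨
  E g 1s + 3                        ≡⟨ cong (_+ 3) (E-del-total g v) ⟩
  E (del g v) 1s + d g v + 3        ≡⟨ a₂ (E (del g v) 1s) (d g v) ⟩
  (E (del g v) 1s + 3) + d g v      ≤⟨ +-monoˡ-≤ (d g v) rest ⟩
  2 * m + d g v                     ∎)
  where
  open ≤-Reasoning
  a₁ : ∀ m → 2 * suc m ≡ 2 * m + 2
  a₁ = solve-∀
  a₂ : ∀ x y → x + y + 3 ≡ (x + 3) + y
  a₂ = solve-∀
  all : Fin m → Bool
  all _ = true
  size≡ : size (insertAt all v false) ≡ m
  size≡ = trans (size-insertAt g v all) sum-1
  rest : E (del g v) 1s + 3 ≤ 2 * m
  rest = subst₂ _≤_ (cong (_+ 3) (≡.sym (E-del-set g v all))) (cong (2 *_) size≡)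
    (sparse L (insertAt all v false) (subst (2 ≤_) (≡.sym size≡) 2≤m))

edge-tight : (g : GraphOn m) {a c : Fin m} → g ⊢ a ~ c → Tight g (eq a ⊕ c)
edge-tight g {a} {c} a~c = ≤-reflexive (begin
  2 * size (eq a ⊕ c)                        ≡⟨ cong (2 *_) (trans (size-⊕ (eq a) c∉) (cong suc (sum-δ a))) ⟩
  4                                          ≡⟨ cong (_+ 3) (cong₂ _+_ (E-eq g a) (trans (deg-eq g a c) (𝟙-T (~-sym g a~c)))) ⟨
  E g (𝟙 ∘ eq a) + deg g (𝟙 ∘ eq a) c + 3    ≡⟨ cong (_+ 3) (E-⊕ (eq a) c∉ g) ⟨
  E g (𝟙 ∘ (eq a ⊕ c)) + 3                   ∎)
  where
  open ≡-Reasoning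
  c∉ : ¬ T (eq a c)
  c∉ t = ~⇒≢ g a~c (T-eq⇒≡ t)

-- An edge `a c` would itself be a tight set avoiding `v`, which `loose-two-pairs` excludes.
no-K₄ : (g : GraphOn m) → Laman g → ∀ {v a b c} → N3 g v a b c → g ⊢ b ~ a → g ⊢ b ~ c → ¬ g ⊢ a ~ c
no-K₄ g L {v} {a} {b} {c} N b~a b~c a~c = loose-two-pairs g L N b~a b~c (eq a ⊕ c)
  (λ t → [ (λ q → ~⇒≢ g (N3.v~a N) (≡.sym (T-eq⇒≡ q))) , (λ q → ~⇒≢ g (N3.v~c N) (≡.sym q)) ]′ (⊕⁻ (eq a) t))
  (⊕-old (eq a) {c} (≡⇒T-eq {x = a} refl)) (⊕-new (eq a)) (edge-tight g a~c)

-- Reductions and case analysis by minimum degree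

Outcome : GraphOn m → Set
Outcome g = HasNAC (graph g) ⊎ Σ Graph (λ G̃ → IsProblematic G̃ × ¬ HasNAC G̃ × ConstructibleFrom G̃ (graph g))

Solved : ℕ → Set
Solved k = (g : GraphOn k) → Laman g → ¬ TriConnected (graph g) → Outcome g

Below : ℕ → Set
Below k = ∀ {j} → j < k → Solved j

two-pairs : Below m → (g : GraphOn m) → Laman g → (∀ z → 3 ≤ d g z) →
  ∀ {v a b c} → N3 g v a b c → g ⊢ b ~ a → g ⊢ b ~ c → ¬ g ⊢ a ~ c → Outcome g
two-pairs {zero} _ _ _ _ {()}
two-pairs {suc m} IH g L d≥3 {v} N b~a b~c a≁c
  with unpunch v (~⇒≢ g (N3.v~a N)) | unpunch v (~⇒≢ g (N3.v~b N)) | unpunch v (~⇒≢ g (N3.v~c N))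
... | a , refl | b , refl | c , refl = outcome (IH ≤-refl g′ L′ not-tri)
  where
  a≢c : a ≢ c
  a≢c = N3.a≢c N ∘ cong (punchIn v)
  g′ = del-add g v a≢c a≁c
  L′ : Laman g′
  L′ = del-add-laman g v a≢c a≁c L (d-N3 g N) (loose-two-pairs g L N b~a b~c)
  new : ∀ {x y} → del g v ⊢ x ~ y → g′ ⊢ x ~ y
  new = ~-add⁺ (del g v) a≢c
  not-tri : ¬ TriConnected (graph g′)
  not-tri tc = triConnected⇒degree-2 g′ L′ tc {w = b}
    (λ z z≢b → subst (3 ≤_) (trans (≡.sym (d-N3-reduce g N a≢c a≁c z))
      (trans (cong (d g′ z +_) (δ-≢ (z≢b ∘ ≡.sym))) (+-identityʳ _))) (d≥3 (punchIn v z)))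
    (new b~a)
  outcome : Outcome g′ → Outcome g
  outcome (inj₂ (G̃ , prob , none , con)) =
    inj₂ (G̃ , prob , none , step con (fromLaman g L) (inj₂ (N3-hennebergII g N a≢c a≁c)))
  outcome (inj₁ nac) with NAC⇒rook g′ nac
  -- Two edges of the triangle `a b c` preserving the same labelling force the third to preserve it.
  -- Hence the triangle has one color, and the neighbours of `v` share a label in the corresponding
  -- labelling.
  ... | r , β , ρ with IsRook.edge-kind ρ (new b~a) | IsRook.edge-kind ρ (new b~c) | IsRook.edge-kind ρ (~-add-new (del g v) a≢c)
  ...   | inj₁ (p , _) | inj₁ (q , _) | _            = inj₁ (N3-extend-NAC g N a≢c a≁c _≟_ ρ (≡.sym p) q)
  ...   | inj₂ (p , _) | inj₂ (q , _) | _            = inj₁ (N3-extend-NAC g N a≢c a≁c _≟_ (IsRook-swap ρ) (≡.sym p) q)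
  ...   | inj₁ (p , _) | inj₂ (_ , q) | inj₁ (s , _) = contradiction (trans p s) q
  ...   | inj₁ (_ , p) | inj₂ (q , _) | inj₂ (s , _) = contradiction (trans q (≡.sym s)) p
  ...   | inj₂ (_ , p) | inj₁ (q , _) | inj₁ (s , _) = contradiction (trans q (≡.sym s)) p
  ...   | inj₂ (p , _) | inj₁ (_ , q) | inj₂ (s , _) = contradiction (trans p s) q

record Obstruction (g : GraphOn m) (v a b c : Fin m) (S : Fin m → Bool) : Set where
  field
    v∉    : ¬ T (S v)
    a∉    : ¬ T (S a)
    b∈    : T (S b)
    c∈    : T (S c)
    tight : Tight g S

-- Obstructions are the tight sets that forbid the new edge `b c` in the reduction deleting `v` and
-- `a`. Finding one is what triggers the exchange of `v` and `a` in `one-pair`.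
obstruction? : (g : GraphOn m) (v a b c : Fin m) → Dec (∃ (Obstruction g v a b c))
obstruction? {m} g v a b c = searchable-→ searchable-Bool {P = Obstruction g v a b c} respects dec
  where
  open Obstruction
  respects : ∀ {S S′} → S ≗ S′ → Obstruction g v a b c S → Obstruction g v a b c S′
  respects {S} {S′} e o = record
    { v∉    = v∉ o ∘ subst T (≡.sym (e v))
    ; a∉    = a∉ o ∘ subst T (≡.sym (e a))
    ; b∈    = subst T (e b) (b∈ o)
    ; c∈    = subst T (e c) (c∈ o)
    ; tight = subst₂ _≤_ (cong (2 *_) (sum-cong-≗ {m} (cong 𝟙 ∘ e))) (cong (_+ 3) (E-cong g (cong 𝟙 ∘ e))) (tight o)
    }
  dec : ∀ S → Dec (Obstruction g v a b c S)
  dec S = map′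
    (λ (p , q , s , t , u) → record { v∉ = p ; a∉ = q ; b∈ = s ; c∈ = t ; tight = u })
    (λ o → v∉ o , a∉ o , b∈ o , c∈ o , tight o)
    (¬? (T? (S v)) ×-dec ¬? (T? (S a)) ×-dec T? (S b) ×-dec T? (S c) ×-dec (2 * size S ≤? E g (𝟙 ∘ S) + 3))

-- The reduction undoes two moves. In `H`, which is G without `v` and with `b c` added (type II),
-- the vertex `a` has only the neighbours `b` and `x` left; deleting it gives `K` (type I).
adjacent-degree-3 : Below m → (g : GraphOn m) → Laman g → (∀ z → 3 ≤ d g z) → ∀ {v a b c x} → N3 g v a b c → N3 g a v b x →
  ¬ g ⊢ a ~ c → ¬ g ⊢ b ~ c → g ⊢ c ~ x → 4 ≤ d g b →
  (∀ S → ¬ T (S v) → ¬ T (S a) → T (S b) → T (S c) → ¬ Tight g S) → Outcome g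
adjacent-degree-3 {zero} _ _ _ _ {()}
adjacent-degree-3 {suc zero} _ g _ _ {zero} {zero} Nv = contradiction refl (~⇒≢ g (N3.v~a Nv))
adjacent-degree-3 {suc (suc m)} IH g L d≥3 {v} {a} Nv Na a≁c b≁c c~x 4≤db loose
  with unpunch v (~⇒≢ g (N3.v~a Nv)) | unpunch v (~⇒≢ g (N3.v~b Nv)) | unpunch v (~⇒≢ g (N3.v~c Nv)) | unpunch v (N3.a≢c Na)
... | a₁ , refl | b₁ , refl | c₁ , refl | x₁ , refl
  with unpunch a₁ (N3.a≢b Nv ∘ cong (punchIn v)) | unpunch a₁ (N3.a≢c Nv ∘ cong (punchIn v)) | unpunch a₁ (~⇒≢ g (N3.v~c Na) ∘ cong (punchIn v))
...   | b₂ , refl | c₂ , refl | x₂ , refl = outcome (IH (n≤1+n _) K LK not-tri)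
  where
  b₁′ = punchIn a₁ b₂
  c₁′ = punchIn a₁ c₂
  b₁≢c₁ : b₁′ ≢ c₁′
  b₁≢c₁ = N3.b≢c Nv ∘ cong (punchIn v)
  H = del-add g v b₁≢c₁ b≁c
  new : ∀ {x y} → del g v ⊢ x ~ y → H ⊢ x ~ y
  new = ~-add⁺ (del g v) b₁≢c₁
  loose′ : ∀ S → ¬ T (S v) → T (S (punchIn v b₁′)) → T (S (punchIn v c₁′)) → ¬ Tight g S
  loose′ S v∉S Sb Sc tight with T? (S a)
  ... | no a∉S = loose S v∉S a∉S Sb Sc tight
  ... | yes Sa = loose (S ∖ a) (v∉S ∘ proj₁ ∘ ∖⁻ S {a}) (λ t → proj₂ (∖⁻ S {a} t) refl)
          (∖⁺ S Sb (N3.a≢b Nv)) (∖⁺ S Sc (N3.a≢c Nv)) (tight-∖ g L Na S v∉S Sa tight)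
  LH : Laman H
  LH = del-add-laman g v b₁≢c₁ b≁c L (d-N3 g Nv) loose′
  NH : N2 H a₁ b₁′ (punchIn a₁ x₂)
  NH = n2 (N3.b≢c Na ∘ cong (punchIn v)) (new (N3.v~b Na)) (new (N3.v~c Na)) λ e → only (~-add⁻ (del g v) b₁≢c₁ e)
    where
    only : ∀ {y} → (del g v ⊢ a₁ ~ y ⊎ (a₁ ≡ b₁′ × y ≡ c₁′) ⊎ (a₁ ≡ c₁′ × y ≡ b₁′)) → y ≡ b₁′ ⊎ y ≡ punchIn a₁ x₂
    only (inj₂ (inj₁ (p , _))) = contradiction (≡.sym p) (punchInᵢ≢i a₁ b₂)
    only (inj₂ (inj₂ (p , _))) = contradiction (≡.sym p) (punchInᵢ≢i a₁ c₂)
    only (inj₁ e) with N3.only Na e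
    ... | inj₁ p        = contradiction p (punchInᵢ≢i v _)
    ... | inj₂ (inj₁ p) = inj₁ (punchIn-injective v _ _ p)
    ... | inj₂ (inj₂ p) = inj₂ (punchIn-injective v _ _ p)
  K = del H a₁
  LK : Laman K
  LK = del-laman H a₁ LH (d-N2 H NH)
  b~c : K ⊢ b₂ ~ c₂
  b~c = ~-add-new (del g v) b₁≢c₁
  c~x′ : K ⊢ c₂ ~ x₂
  c~x′ = new c~x
  N3-bac : N3 g v (punchIn v b₁′) (punchIn v a₁) (punchIn v c₁′)
  N3-bac = N3-swap Nv
  -- `b` loses `v` and `a` and gains `c`, `c` exchanges `v` for `b`, and `x` loses `a`. So `b` keeps
  -- degree 3 thanks to `4 ≤ d g b`, and `x` is the one exceptional vertex.
  d-K : ∀ z → z ≢ x₂ → d g (punchIn v (punchIn a₁ z)) ≡ δ b₂ z + d K z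
  d-K z z≢x₂ = begin
    d g (punchIn v (punchIn a₁ z))                    ≡⟨ d-N3-reduce g N3-bac b₁≢c₁ b≁c (punchIn a₁ z) ⟨
    d H (punchIn a₁ z) + δ a₁ (punchIn a₁ z)          ≡⟨ cong₂ _+_ (d-del H a₁ z) (δ-≢ (punchInᵢ≢i a₁ z ∘ ≡.sym)) ⟩
    A H a₁ (punchIn a₁ z) + d K z + 0                 ≡⟨ +-identityʳ _ ⟩
    A H a₁ (punchIn a₁ z) + d K z                     ≡⟨ cong (_+ d K z) (N2-A H NH (punchIn a₁ z)) ⟩
    δ b₁′ (punchIn a₁ z) + δ (punchIn a₁ x₂) (punchIn a₁ z) + d K z
      ≡⟨ cong (_+ d K z) (cong₂ _+_ (δ-punchIn a₁ b₂ z) (trans (δ-punchIn a₁ x₂ z) (δ-≢ (z≢x₂ ∘ ≡.sym)))) ⟩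
    δ b₂ z + 0 + d K z                                ≡⟨ cong (_+ d K z) (+-identityʳ _) ⟩
    δ b₂ z + d K z                                    ∎
    where open ≡-Reasoning
  deg≥3 : ∀ z → z ≢ x₂ → 3 ≤ d K z
  deg≥3 z z≢x₂ with b₂ ≟ z | d-K z z≢x₂
  ... | yes refl | e = ≤-pred (subst (4 ≤_) e 4≤db)
  ... | no _     | e = subst (3 ≤_) e (d≥3 _)
  not-tri : ¬ TriConnected (graph K)
  not-tri tc = triConnected⇒degree-2 K LK tc deg≥3 (~-sym K c~x′)
  extend-NAC : DecidableEquality R → {r : Fin m → R} {β : Fin m → B} → IsRook K r β → Agree r β b₂ c₂ → HasNAC (graph g)
  extend-NAC _≟R_ {r} {β} ρ (rb≡rc , _) with IsRook.edge-kind ρ c~x′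
  -- `b`, `c` and `x` share a component, which `a` joins. In both cases the aim is that `a`, `b`,
  -- `c` get the same label, so that `v` can be attached and `b c` removed.
  ... | inj₁ (rc≡rx , _) = N3-extend-NAC g N3-bac b₁≢c₁ b≁c _≟R_
          (N2-extend-rook H NH ρ (trans rb≡rc rc≡rx))
          (trans (insertAt-punchIn r a₁ (r b₂) b₂) (≡.sym (insertAt-lookup r a₁ (r b₂))))
          (trans (insertAt-lookup r a₁ (r b₂)) (trans rb≡rc (≡.sym (insertAt-punchIn r a₁ (r b₂) c₂))))
  -- `c b` and `c x` have different colors, so `a`, whose neighbours are now `b` and `x`, becomes a
  -- twin of `c`.
  ... | inj₂ _ = N3-extend-NAC g N3-bac b₁≢c₁ b≁c _≟R_
          (twin-rook H a₁ K ρ c₂ id id (λ e → [ (λ p → subst (K ⊢ c₂ ~_) (≡.sym (punchIn-injective a₁ _ _ p)) (~-sym K b~c))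
                                              , (λ p → subst (K ⊢ c₂ ~_) (≡.sym (punchIn-injective a₁ _ _ p)) c~x′) ]′ (N2.only NH e)))
          (trans (insertAt-punchIn r a₁ (r c₂) b₂) (trans rb≡rc (≡.sym (insertAt-lookup r a₁ (r c₂)))))
          (trans (insertAt-lookup r a₁ (r c₂)) (≡.sym (insertAt-punchIn r a₁ (r c₂) c₂)))
  outcome : Outcome K → Outcome g
  outcome (inj₂ (G̃ , prob , none , con)) = inj₂ (G̃ , prob , none ,
    step (step con (fromLaman H LH) (inj₁ (N2-hennebergI H NH))) (fromLaman g L) (inj₂ (N3-hennebergII g N3-bac b₁≢c₁ b≁c)))
  outcome (inj₁ nac) with NAC⇒rook K nac
  ... | r , β , ρ with IsRook.edge-kind ρ b~c
  ...   | inj₁ red-bc  = inj₁ (extend-NAC _≟_ ρ red-bc)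
  ...   | inj₂ blue-bc = inj₁ (extend-NAC _≟_ (IsRook-swap ρ) blue-bc)

-- Everything depends on the third neighbour `x` of `a`. With neither `b x` nor `c x` an edge, the
-- edges at `v` and `a` form a blue class; with `c x` but not `b x` an edge, `b` of degree 3 gives
-- the matching coloring, and `b` of larger degree allows a reduction.
one-pair : Below m → (g : GraphOn m) → Laman g → (∀ z → 3 ≤ d g z) → ∀ {v a b c} → N3 g v a b c →
  g ⊢ a ~ b → ¬ g ⊢ a ~ c → ¬ g ⊢ b ~ c → d g a ≡ 3 → Outcome g
one-pair IH g L d≥3 {v} {a} {b} {c} Nv a~b a≁c b≁c da≡3
  with third-neighbour g da≡3 (~-sym g (N3.v~a Nv)) a~b (~⇒≢ g (N3.v~b Nv))
... | x , Na = cases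
  where
  v≁x : ¬ g ⊢ v ~ x
  v≁x e with N3.only Nv e
  ... | inj₁ refl        = ~⇒≢ g (N3.v~c Na) refl
  ... | inj₂ (inj₁ refl) = N3.b≢c Na refl
  ... | inj₂ (inj₂ refl) = a≁c (N3.v~c Na)
  by-obstruction : ¬ g ⊢ b ~ x → g ⊢ c ~ x → d g b ≢ 3 → Dec (∃ (Obstruction g v a b c)) → Outcome g
  by-obstruction b≁x c~x db≢3 (no none) =
    adjacent-degree-3 IH g L d≥3 Nv Na a≁c b≁c c~x (≤∧≢⇒< (d≥3 b) (db≢3 ∘ ≡.sym))
      λ S p q s t tight → none (S , record { v∉ = p ; a∉ = q ; b∈ = s ; c∈ = t ; tight = tight })
  -- The tight set `S₁` blocks `b c`, so by `not-both-tight` nothing blocks `b x`: the reduction is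
  -- applied with `v` and `a`, and `c` and `x`, exchanged.
  by-obstruction b≁x c~x db≢3 (yes (S₁ , o)) = let open Obstruction in
    adjacent-degree-3 IH g L d≥3 Na Nv v≁x b≁x (~-sym g c~x) (≤∧≢⇒< (d≥3 b) (db≢3 ∘ ≡.sym))
      λ S₂ a∉₂ v∉₂ b∈₂ x∈₂ → not-both-tight g L Nv Na c~x S₁ S₂ (v∉ o) (a∉ o) (b∈ o) (c∈ o) (tight o) v∉₂ a∉₂ b∈₂ x∈₂
  cases : Outcome g
  cases with T? (edge g b x) | T? (edge g c x) | d g b ℕ.≟ 3
  -- Now `b` is joined to both `v` and `x`, so the vertex `a` of degree 3 has two adjacent pairs of
  -- neighbours.
  ... | yes b~x | _       | _        = two-pairs IH g L d≥3 Na (~-sym g (N3.v~b Nv)) b~x v≁x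
  ... | no b≁x  | no c≁x  | _        = inj₁ (double-star-NAC g Nv Na b≁c b≁x c≁x (λ z → ≤-trans (n≤1+n 2) (d≥3 z)) a≁c)
  ... | no b≁x  | yes _   | yes db≡3 =
        let (y , Nb) = third-neighbour g db≡3 (~-sym g (N3.v~b Nv)) (~-sym g a~b) (~⇒≢ g (N3.v~a Nv))
        in inj₁ (matching-NAC g Nv Na Nb a≁c b≁c b≁x)
  ... | no b≁x  | yes c~x | no db≢3  =
        by-obstruction b≁x c~x db≢3 (obstruction? g v a b c)

-- A vertex violating the degree-3 condition settles the whole goal `Z` at once, so the violation
-- never has to be stated as a negation.
all-or : {P : Fin m → Set} {Z : Set} → (∀ i → P i ⊎ Z) → (∀ i → P i) ⊎ Z
all-or {zero}  h = inj₁ λ ()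
all-or {suc m} h with h zero | all-or (h ∘ suc)
... | inj₂ q | _      = inj₂ q
... | inj₁ _ | inj₂ q = inj₂ q
... | inj₁ p | inj₁ f = inj₁ λ { zero → p ; (suc i) → f i }

degree-2-case : Below m → (g : GraphOn m) → Laman g → ¬ TriConnected (graph g) → (∀ z → 2 ≤ d g z) →
  ∀ {v a b} → N2 g v a b → Outcome g
degree-2-case {zero} _ _ _ _ _ {()}
degree-2-case {suc m} IH g L ¬tc d≥2 {v} {a} {b} N with T? (edge g a b)
... | no a≁b = inj₁ (star-NAC g (λ v~x v~y → nonadjacent (N2.only N v~x) (N2.only N v~y)) (N2.v~a N) (proj₁ (proj₂ far)) (proj₂ (proj₂ far)))
  where
  far = other (edge g a) v (d≥2 a)
  nonadjacent : ∀ {x y} → x ≡ a ⊎ x ≡ b → y ≡ a ⊎ y ≡ b → ¬ g ⊢ x ~ y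
  nonadjacent (inj₁ refl) (inj₁ refl) e = ~⇒≢ g e refl
  nonadjacent (inj₁ refl) (inj₂ refl) e = a≁b e
  nonadjacent (inj₂ refl) (inj₁ refl) e = a≁b (~-sym g e)
  nonadjacent (inj₂ refl) (inj₂ refl) e = ~⇒≢ g e refl
... | yes a~b with unpunch v (~⇒≢ g (N2.v~a N)) | unpunch v (~⇒≢ g (N2.v~b N))
...   | u , refl | u′ , refl = outcome (IH ≤-refl (del g v) (del-laman g v L (d-N2 g N)) (¬tc ∘ triConnected-undelete g N a~b))
  where
  outcome : Outcome (del g v) → Outcome g
  outcome (inj₂ (G̃ , prob , none , con)) = inj₂ (G̃ , prob , none , step con (fromLaman g L) (inj₁ (N2-hennebergI g N)))
  outcome (inj₁ nac) with NAC⇒rook (del g v) nac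
  ... | r , β , ρ with IsRook.edge-kind ρ a~b
  ...   | inj₁ (p , _) = inj₁ (rook⇒NAC g _≟_ (N2-extend-rook g N ρ p))
  ...   | inj₂ (p , _) = inj₁ (rook⇒NAC g _≟_ (N2-extend-rook g N (IsRook-swap ρ) p))

Triangle : GraphOn m → Fin m → Set
Triangle g v = ∃[ b ] ∃[ c ] IsTriangle (graph g) v b c

triangle? : (g : GraphOn m) → ∀ v → Dec (Triangle g v)
triangle? g v = any? λ b → any? λ c → T? (edge g v b) ×-dec T? (edge g b c) ×-dec T? (edge g v c)

module _ (g : GraphOn m) (L : Laman g) (IH : Below m) (d≥3 : ∀ z → 3 ≤ d g z) where

  triangle-free-NAC : ∀ v → ¬ Triangle g v → HasNAC (graph g)
  triangle-free-NAC v none =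
    let (u , v~u) = nonempty (edge g v) (≤-trans (s≤s z≤n) (d≥3 v))
        (w , u~w , v≢w) = other (edge g u) v (≤-trans (n≤1+n 2) (d≥3 u))
    in star-NAC g (λ {x} {y} v~x v~y x~y → none (x , y , v~x , x~y , v~y)) v~u u~w v≢w

  Degree-3-condition : Fin m → Set
  Degree-3-condition v = degree (graph g) v ≡ 3 → ∃[ a ] ∃[ b ] ∃[ c ]
    (g ⊢ v ~ a × g ⊢ v ~ b × g ⊢ v ~ c × a ≢ b × a ≢ c × b ≢ c × g ⊢ a ~ b × ¬ g ⊢ a ~ c × ¬ g ⊢ b ~ c ×
     4 ≤ degree (graph g) a × 4 ≤ degree (graph g) b)

  degree-3-case : ∀ v → Triangle g v → Degree-3-condition v ⊎ Outcome g
  degree-3-case v (a , b , v~a , a~b , v~b) with d g v ℕ.≟ 3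
  ... | no dv≢3 = inj₁ λ e → contradiction (trans (≡.sym (degree≡d g v)) e) dv≢3
  ... | yes dv≡3 with third-neighbour g dv≡3 v~a v~b (~⇒≢ g a~b)
  ...   | c , N with T? (edge g a c) | T? (edge g b c)
  ...     | yes a~c | yes b~c = contradiction a~c (no-K₄ g L N (~-sym g a~b) b~c)
  ...     | yes a~c | no b≁c  = inj₂ (two-pairs IH g L d≥3 (N3-swap N) a~b a~c b≁c)
  ...     | no a≁c  | yes b~c = inj₂ (two-pairs IH g L d≥3 N (~-sym g a~b) b~c a≁c)
  ...     | no a≁c  | no b≁c with d g a ℕ.≟ 3 | d g b ℕ.≟ 3
  ...       | yes da≡3 | _        = inj₂ (one-pair IH g L d≥3 N a~b a≁c b≁c da≡3)
  ...       | no _     | yes db≡3 = inj₂ (one-pair IH g L d≥3 (N3-swap N) (~-sym g a~b) b≁c a≁c db≡3)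
  ...       | no da≢3  | no db≢3  = inj₁ λ _ → a , b , c , v~a , v~b , N3.v~c N , N3.a≢b N , N3.a≢c N , N3.b≢c N ,
              a~b , a≁c , b≁c , at-least-4 da≢3 , at-least-4 db≢3
    where
    at-least-4 : ∀ {z} → d g z ≢ 3 → 4 ≤ degree (graph g) z
    at-least-4 {z} dz≢3 = subst (4 ≤_) (≡.sym (degree≡d g z)) (≤∧≢⇒< (d≥3 z) (dz≢3 ∘ ≡.sym))

  min-degree-3-case : Outcome g
  min-degree-3-case = by-triangles (all? (triangle? g))
    where
    problematic : (∀ v → Triangle g v) → (∀ v → Degree-3-condition v) → IsProblematic (graph g)
    problematic tri deg-3 = fromLaman g L , (λ v → subst (3 ≤_) (≡.sym (degree≡d g v)) (d≥3 v)) , deg-3 , tri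
    by-NAC : IsProblematic (graph g) → Dec (HasNAC (graph g)) → Outcome g
    by-NAC _    (yes nac) = inj₁ nac
    by-NAC prob (no ¬nac) = inj₂ (graph g , prob , ¬nac , done (fromLaman g L))
    by-triangles : Dec (∀ v → Triangle g v) → Outcome g
    by-triangles (no ¬all) = let (v , none) = ¬∀⟶∃¬ _ _ (triangle? g) ¬all in inj₁ (triangle-free-NAC v none)
    by-triangles (yes tri) =
      [ (λ deg-3 → by-NAC (problematic tri deg-3) (hasNAC? g)) , id ]′ (all-or λ v → degree-3-case v (tri v))

K₂-triConnected : (g : GraphOn 2) → TriConnected (graph g)
K₂-triConnected g ((zero , suc zero) , p , t) ((zero , suc zero) , q , s)
  rewrite <-irrelevant p q | T-irrelevant t s = ε
K₂-triConnected g ((zero , zero) , () , _) _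
K₂-triConnected g ((suc zero , zero) , () , _) _
K₂-triConnected g ((suc zero , suc zero) , s≤s () , _) _
K₂-triConnected g ((zero , suc zero) , _) ((zero , zero) , () , _)
K₂-triConnected g ((zero , suc zero) , _) ((suc zero , zero) , () , _)
K₂-triConnected g ((zero , suc zero) , _) ((suc zero , suc zero) , s≤s () , _)

by-min-degree : (g : GraphOn m) → Laman g → ¬ TriConnected (graph g) → Below m → (∀ z → 2 ≤ d g z) → Outcome g
by-min-degree g L ¬tc IH d≥2 = by-degree (any? λ v → d g v ℕ.≟ 2)
  where
  by-degree : Dec (∃ λ v → d g v ≡ 2) → Outcome g
  by-degree (yes (v , dv≡2)) = let (_ , _ , N) = degree-2 g v dv≡2 in degree-2-case IH g L ¬tc d≥2 N
  by-degree (no none) = min-degree-3-case g L IH λ z → ≤∧≢⇒< (d≥2 z) λ e → none (z , ≡.sym e)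

-- The induction is well-founded because one of the reductions removes two vertices. With 0 or 1
-- vertices the equation for the total number of edges has no solution.
solved : ∀ m → Acc _<_ m → Solved m
solved 0 _ g L _ with total L
... | ()
solved 1 _ g L _ with total L
... | ()
solved 2 _ g L ¬tc = contradiction (K₂-triConnected g) ¬tc
solved (suc (suc (suc m))) (acc rec) g L ¬tc =
  by-min-degree g L ¬tc (λ j< → solved _ (rec j<)) (min-degree g L (s≤s (s≤s z≤n)))

theorem6 : (G : Graph) → IsLaman G → ¬ TriConnected G →
    HasNAC G ⊎ Σ Graph (λ G̃ → IsProblematic G̃ × ¬ HasNAC G̃ × ConstructibleFrom G̃ G)
theorem6 G L = solved (n G) (<-wellFounded (n G)) g (toLaman g L)
  where
  g : GraphOn (n G)
  g = record { edge = adj G ; edge-sym = Graph.sym G ; edge-irrefl = irrefl G }
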